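{- Let $d\ge 2$ and let $D$ be a $d$-ary tree with at least two leaves, with branches $D_1,D_2,\ldots,D_d$ (some of which may be empty). Then $$I_d(D)\ge\binom{\|D\|}{\|D_1\|,\|D_2\|,\ldots,\|D_d\|}\,\|D\|^{ -\|D\|}\,\prod_{i=1}^d\|D_i\|^{\|D_i\|}\,\prod_{i=1}^d I_d(D_i).$$
   Context: A $d$-ary tree is a finite rooted tree in which every internal (non-leaf) vertex has at least two and at most $d$ children; a single vertex is a $d$-ary tree with one leaf, and the empty tree with $0$ leaves is also allowed. Isomorphism means root-preserving isomorphism. $\|T\|$ denotes the number of leaves of $T$. A set $S$ of leaves of $T$ induces a $d$-ary tree: take the smallest subtree of $T$ containing all leaves in $S$ (rooted at the most recent common ancestor of $S$) and repeatedly suppress every vertex with exactly one child (contracting its two adjacent edges to a single edge). $c(D,T)$ is the number of sets of $\|D\|$ leaves of $T$ that induce a tree isomorphic to $D$, and $\gamma(D,T)=c(D,T)/\binom{\|T\|}{\|D\|}$. The $d$-ary inducibility of a nonempty $d$-ary tree $D$ is $$I_d(D)=\limsup_{n\to\infty}\ \max_{\substack{\|T\|=n\\ T\ d\text{ -ary tree}}}\gamma(D,T),$$ and $I_d(D)=1$ if $D$ is empty. The branches of a $d$-ary tree $D$ with at least two leaves are the components (rooted at the children of the root) obtained on removing the root; the list is padded with empty trees to have exactly $d$ entries $D_1,\ldots,D_d$. The convention $0^0=1$ is used. -}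

module Defs where

open import Data.Bool.Base using (true; false)
open import Data.Empty using (⊥-elim)
open import Data.Fin.Subset using (Subset; inside; outside; ∣_∣)
open import Data.Integer.Base using (+_)
open import Data.List.Base as List
  using (List; []; _∷_; _++_; [_]; length; filter; upTo; concatMap; cartesianProductWith)
open import Data.List.Membership.Propositional using (_∈_; find; lose)
open import Data.List.Membership.Propositional.Properties
  using (∈-∃++; ∈-map⁺; ∈-concatMap⁺; ∈-upTo⁺; ∈-filter⁺; ∈-filter⁻; ∈-cartesianProductWith⁺)
open import Data.List.Relation.Binary.Permutation.Homogeneous as Perm using (Permutation)
import Data.List.Relation.Binary.Permutation.Setoid.Properties as PermutationProperties
open import Data.List.Relation.Binary.Pointwise.Base using (Pointwise; []; _∷_)
open import Data.List.Relation.Unary.All as All using (All; []; _∷_)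
open import Data.List.Relation.Unary.Any as Any using (here; there; any?)
open import Data.Maybe.Base using (Maybe; just; nothing; fromMaybe)
import Data.Maybe.Base as Maybe
import Data.Maybe.Relation.Binary.Pointwise as MaybePointwise
import Data.Maybe.Relation.Unary.All as MaybeAll
open import Data.Nat.Base as ℕ using (ℕ; zero; suc; NonZero; s≤s; z≤n; _!)
import Data.Nat.Properties as ℕₚ
open import Data.Nat.Combinatorics using (_C_)
open import Data.Product using (Σ; ∃; _×_; _,_; proj₁; proj₂)
open import Data.Rational.Base using (ℚ; 0ℚ; 1ℚ; _/_; nonNegative)
  renaming (_<_ to _<ℚ_; _≤_ to _≤ℚ_; _*_ to _*ℚ_)
import Data.Rational.Properties as ℚₚ
open import Relation.Binary.Bundles using (DecTotalOrder; Setoid)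
open import Data.List.Extrema (DecTotalOrder.totalOrder ℚₚ.≤-decTotalOrder) using (max; ⊥≤max)
open import Data.Sum.Base using (_⊎_; inj₁; inj₂)
open import Data.Vec.Base as Vec using (Vec; []; _∷_)
open import Function.Base using (_∘_; flip)
open import Level using (0ℓ)
open import Relation.Binary.PropositionalEquality using (_≡_; refl; cong; subst)
open import Relation.Nullary.Decidable using (Dec; yes; no; _×-dec_; map′)

------------------------------------------------------------------------
-- Rooted trees

-- A nonempty finite rooted tree is given by the list of its branches. The
-- order of the branches is an artefact of the encoding, which isomorphism
-- ignores.

data Tree⁺ : Set where
  node : List Tree⁺ → Tree⁺

-- `nothing` is the empty tree.

Tree : Set
Tree = Maybe Tree⁺

mutual
  ‖_‖⁺ : Tree⁺ → ℕ
  ‖ node []       ‖⁺ = 1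
  ‖ node (t ∷ ts) ‖⁺ = ‖ t ∷ ts ‖*

  ‖_‖* : List Tree⁺ → ℕ
  ‖ []     ‖* = 0
  ‖ t ∷ ts ‖* = ‖ t ‖⁺ ℕ.+ ‖ ts ‖*

‖_‖ : Tree → ℕ
‖ nothing ‖ = 0
‖ just t  ‖ = ‖ t ‖⁺

data Dary⁺ (d : ℕ) : Tree⁺ → Set where
  leaf : Dary⁺ d (node [])
  node : ∀ {ts} → 2 ℕ.≤ length ts → length ts ℕ.≤ d → All (Dary⁺ d) ts →
         Dary⁺ d (node ts)

Dary : ℕ → Tree → Set
Dary d = MaybeAll.All (Dary⁺ d)

-- The value is meaningful for trees with at least two leaves only.

branches : ∀ {d} (D : Tree) → Dary d D → Vec Tree d
branches nothing          _                             = Vec.replicate _ nothing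
branches (just (node _))  (MaybeAll.just leaf)          = Vec.replicate _ nothing
branches (just (node ts)) (MaybeAll.just (node _ ≤d _)) =
  Vec.padRight ≤d nothing (Vec.map just (Vec.fromList ts))

------------------------------------------------------------------------
-- Root-preserving isomorphism

infix 4 _≅⁺_ _≅⁺?_ _≅_ _≅?_

data _≅⁺_ : Tree⁺ → Tree⁺ → Set where
  node : ∀ {ts us} → Permutation _≅⁺_ ts us → node ts ≅⁺ node us

_≅_ : Tree → Tree → Set
_≅_ = MaybePointwise.Pointwise _≅⁺_

mutual
  ≅⁺-refl : ∀ {t} → t ≅⁺ t
  ≅⁺-refl {node ts} = node (Perm.refl (≅*-refl ts))

  ≅*-refl : ∀ ts → Pointwise _≅⁺_ ts ts
  ≅*-refl []       = []
  ≅*-refl (t ∷ ts) = ≅⁺-refl ∷ ≅*-refl ts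

≅⁺-trans : ∀ {t u v} → t ≅⁺ u → u ≅⁺ v → t ≅⁺ v
≅⁺-trans (node p) (node q) = node (Perm.trans p q)

mutual
  ≅⁺-sym : ∀ {t u} → t ≅⁺ u → u ≅⁺ t
  ≅⁺-sym (node p) = node (↭-sym p)

  ↭-sym : ∀ {ts us} → Permutation _≅⁺_ ts us → Permutation _≅⁺_ us ts
  ↭-sym (Perm.refl ps)    = Perm.refl (≅*-sym ps)
  ↭-sym (Perm.prep p q)   = Perm.prep (≅⁺-sym p) (↭-sym q)
  ↭-sym (Perm.swap p q r) = Perm.swap (≅⁺-sym q) (≅⁺-sym p) (↭-sym r)
  ↭-sym (Perm.trans p q)  = Perm.trans (↭-sym q) (↭-sym p)

  ≅*-sym : ∀ {ts us} → Pointwise _≅⁺_ ts us → Pointwise _≅⁺_ us ts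
  ≅*-sym []       = []
  ≅*-sym (p ∷ ps) = ≅⁺-sym p ∷ ≅*-sym ps

≅⁺-setoid : Setoid 0ℓ 0ℓ
≅⁺-setoid = record
  { _≈_           = _≅⁺_
  ; isEquivalence = record { refl = ≅⁺-refl ; sym = ≅⁺-sym ; trans = ≅⁺-trans }
  }

private module ↭ = PermutationProperties ≅⁺-setoid

mutual
  _≅⁺?_ : ∀ t u → Dec (t ≅⁺ u)
  node ts ≅⁺? node us = map′ node (λ { (node p) → p }) (ts ↭? us)

  _↭?_ : ∀ ts us → Dec (Permutation _≅⁺_ ts us)
  []       ↭? []       = yes (Perm.refl [])
  []       ↭? (u ∷ us) = no λ p → case-length (↭.xs↭ys⇒|xs|≡|ys| p)
    where
    case-length : ∀ {n} {A : Set} → 0 ≡ suc n → A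
    case-length ()
  (t ∷ ts) ↭? us with any? (λ u → t ≅⁺? u) us
  ... | no t∉us = no λ p → t∉us (↭.∈-resp-↭ p (here ≅⁺-refl))
  ... | yes t∈us with find t∈us
  ...   | u , u∈us , t≅u with ∈-∃++ u∈us
  ...     | vs , ws , refl = map′
    (λ p → Perm.trans (Perm.prep t≅u p) (↭-sym (↭.↭-shift vs ws)))
    (λ p → ↭.dropMiddleElement [] []
             (Perm.trans (Perm.prep (≅⁺-sym t≅u) (Perm.refl (≅*-refl ts)))
                (Perm.trans p (↭.↭-shift vs ws))))
    (ts ↭? (vs ++ ws))

_≅?_ : ∀ T U → Dec (T ≅ U)
_≅?_ = MaybePointwise.dec _≅⁺?_

------------------------------------------------------------------------
-- Trees induced by sets of leaves

-- A set of leaves of T is a `Subset ‖ T ‖`, the leaves being numbered from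
-- left to right.

-- `hull` consists of the vertices having an element of S below or at them,
-- that is, of the paths from the root to the elements of S.

join : List Tree⁺ → Tree
join []       = nothing
join (t ∷ ts) = just (node (t ∷ ts))

mutual
  hull : (t : Tree⁺) → Subset ‖ t ‖⁺ → Tree
  hull (node [])       (true  ∷ []) = just (node [])
  hull (node [])       (false ∷ []) = nothing
  hull (node (t ∷ ts)) S = join (hull* (t ∷ ts) S)

  hull* : (ts : List Tree⁺) → Subset ‖ ts ‖* → List Tree⁺
  hull* []       _ = []
  hull* (t ∷ ts) S =
    List.fromMaybe (hull t (Vec.take ‖ t ‖⁺ S)) ++ hull* ts (Vec.drop ‖ t ‖⁺ S)

-- Suppression of all vertices with exactly one child. A root with one child
-- is removed as well, so the path from the root of T to the most recent common
-- ancestor of S disappears and the latter becomes the root.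

mutual
  suppress : Tree⁺ → Tree⁺
  suppress (node [])           = node []
  suppress (node (t ∷ []))     = suppress t
  suppress (node (t ∷ u ∷ ts)) = node (suppress t ∷ suppress u ∷ suppress* ts)

  suppress* : List Tree⁺ → List Tree⁺
  suppress* []       = []
  suppress* (t ∷ ts) = suppress t ∷ suppress* ts

induced : (T : Tree) → Subset ‖ T ‖ → Tree
induced nothing  S = nothing
induced (just t) S = Maybe.map suppress (hull t S)

allSubsets : ∀ n → List (Subset n)
allSubsets zero    = [ [] ]
allSubsets (suc n) = List.map (inside ∷_) (allSubsets n) ++ List.map (outside ∷_) (allSubsets n)

c : Tree → Tree → ℕ
c D T = length (filter (λ S → (∣ S ∣ ℕₚ.≟ ‖ D ‖) ×-dec (induced T S ≅? D)) (allSubsets ‖ T ‖))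

-- The quotient m/n, with the convention m/0 = 0. In γ, division by 0 occurs
-- for ‖ T ‖ < ‖ D ‖ only.

ratio : ℕ → ℕ → ℚ
ratio m zero      = 0ℚ
ratio m n@(suc _) = + m / n

γ : Tree → Tree → ℚ
γ D T = ratio (c D T) (‖ T ‖ C ‖ D ‖)

------------------------------------------------------------------------
-- The d-ary trees with n leaves

tuples : ∀ {A : Set} → ℕ → List A → List (List A)
tuples zero    xs = [ [] ]
tuples (suc k) xs = cartesianProductWith _∷_ xs (tuples k xs)

-- All trees with fewer than h levels below the root in which every vertex has
-- at most d children.

treesOfHeight< : ℕ → ℕ → List Tree⁺
treesOfHeight< d zero    = []
treesOfHeight< d (suc h) =
  concatMap (λ k → List.map node (tuples k (treesOfHeight< d h))) (upTo (suc d))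

mutual
  dary⁺? : ∀ d t → Dec (Dary⁺ d t)
  dary⁺? d (node [])       = yes leaf
  dary⁺? d (node (t ∷ ts)) =
    map′ (λ (p , q , r) → node p q r) (λ { (node p q r) → p , q , r })
      ((2 ℕₚ.≤? length (t ∷ ts)) ×-dec ((length (t ∷ ts) ℕₚ.≤? d) ×-dec dary*? d (t ∷ ts)))

  dary*? : ∀ d ts → Dec (All (Dary⁺ d) ts)
  dary*? d []       = yes []
  dary*? d (t ∷ ts) =
    map′ (λ (p , q) → p ∷ q) (λ { (p ∷ q) → p , q }) (dary⁺? d t ×-dec dary*? d ts)

dary? : ∀ d T → Dec (Dary d T)
dary? d = MaybeAll.dec (dary⁺? d)

-- Height < n suffices, because every internal vertex has at least two children.

daryTrees : ℕ → ℕ → List Tree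
daryTrees d n =
  filter (λ T → (‖ T ‖ ℕₚ.≟ n) ×-dec dary? d T)
         (nothing ∷ List.map just (treesOfHeight< d n))

daryTrees-sound : ∀ {d n T} → T ∈ daryTrees d n → ‖ T ‖ ≡ n × Dary d T
daryTrees-sound {d} {n} T∈ =
  proj₂ (∈-filter⁻ (λ T → (‖ T ‖ ℕₚ.≟ n) ×-dec dary? d T)
                   {xs = nothing ∷ List.map just (treesOfHeight< d n)} T∈)

tuples-complete : ∀ {A : Set} {xs ys : List A} → All (_∈ xs) ys → ys ∈ tuples (length ys) xs
tuples-complete []       = here refl
tuples-complete (p ∷ ps) = ∈-cartesianProductWith⁺ _∷_ p (tuples-complete ps)

‖‖⁺>0 : ∀ t → 1 ℕ.≤ ‖ t ‖⁺
‖‖⁺>0 (node [])       = s≤s z≤n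
‖‖⁺>0 (node (t ∷ ts)) = ℕₚ.≤-trans (‖‖⁺>0 t) (ℕₚ.m≤m+n _ _)

mutual
  treesOfHeight<-complete : ∀ {d} h {t} → Dary⁺ d t → ‖ t ‖⁺ ℕ.≤ h → t ∈ treesOfHeight< d h
  treesOfHeight<-complete zero {t} _ ≤h = ⊥-elim (ℕₚ.<⇒≱ (‖‖⁺>0 t) ≤h)
  treesOfHeight<-complete {d} (suc h) leaf _ = treesOfHeight<-node d h [] z≤n []
  treesOfHeight<-complete {d} (suc h) {node (t ∷ u ∷ ts)} (node _ ≤d (p ∷ q ∷ ps)) ≤h =
    treesOfHeight<-node d h (t ∷ u ∷ ts) ≤d
      ( treesOfHeight<-complete h p (ℕ.s≤s⁻¹ (ℕₚ.≤-trans t< ≤h))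
      ∷ treesOfHeight<-complete* h (q ∷ ps) (ℕ.s≤s⁻¹ (ℕₚ.≤-trans us< ≤h)))
    where
    us< : suc ‖ u ∷ ts ‖* ℕ.≤ ‖ t ∷ u ∷ ts ‖*
    us< = ℕₚ.+-monoˡ-≤ ‖ u ∷ ts ‖* (‖‖⁺>0 t)

    t< : suc ‖ t ‖⁺ ℕ.≤ ‖ t ∷ u ∷ ts ‖*
    t< = subst (ℕ._≤ ‖ t ∷ u ∷ ts ‖*) (ℕₚ.+-comm ‖ t ‖⁺ 1)
           (ℕₚ.+-monoʳ-≤ ‖ t ‖⁺ (ℕₚ.≤-trans (‖‖⁺>0 u) (ℕₚ.m≤m+n _ _)))
  treesOfHeight<-complete (suc h) {node (_ ∷ [])} (node (s≤s ()) _ _) _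

  treesOfHeight<-complete* : ∀ {d} h {ts} → All (Dary⁺ d) ts → ‖ ts ‖* ℕ.≤ h →
                             All (_∈ treesOfHeight< d h) ts
  treesOfHeight<-complete* h []       _  = []
  treesOfHeight<-complete* h (p ∷ ps) ≤h =
    treesOfHeight<-complete h p (ℕₚ.m+n≤o⇒m≤o _ ≤h)
    ∷ treesOfHeight<-complete* h ps (ℕₚ.m+n≤o⇒n≤o _ ≤h)

  treesOfHeight<-node : ∀ d h ts → length ts ℕ.≤ d → All (_∈ treesOfHeight< d h) ts →
                        node ts ∈ treesOfHeight< d (suc h)
  treesOfHeight<-node d h ts ≤d ps =
    ∈-concatMap⁺ (λ k → List.map node (tuples k (treesOfHeight< d h)))
      (lose (∈-upTo⁺ (s≤s ≤d))
        (∈-map⁺ node (tuples-complete ps)))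

daryTrees-complete : ∀ {d T} → Dary d T → T ∈ daryTrees d ‖ T ‖
daryTrees-complete {d} {T} p =
  ∈-filter⁺ (λ U → (‖ U ‖ ℕₚ.≟ ‖ T ‖) ×-dec dary? d U) (candidate p) (refl , p)
  where
  candidate : ∀ {T} → Dary d T → T ∈ (nothing ∷ List.map just (treesOfHeight< d ‖ T ‖))
  candidate MaybeAll.nothing  = here refl
  candidate (MaybeAll.just p) = there (∈-map⁺ just (treesOfHeight<-complete _ p ℕₚ.≤-refl))

-- 0 is a harmless default, as all densities are nonnegative.

maxDensity : ℕ → Tree → ℕ → ℚ
maxDensity d D n = max 0ℚ (List.map (γ D) (daryTrees d n))

maxDensity≥0 : ∀ d D n → 0ℚ ≤ℚ maxDensity d D n
maxDensity≥0 d D n = ⊥≤max 0ℚ (List.map (γ D) (daryTrees d n))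

------------------------------------------------------------------------
-- Extended nonnegative real numbers

-- An element x of [0,∞] is represented by the set of the rational numbers
-- strictly below x. Lower cuts (rather than Dedekind cuts or Cauchy sequences)
-- are used because the limit superior of an arbitrary sequence of rationals
-- exists constructively only in this form. Since all densities are at most 1, the
-- value ∞ does not arise from them.

record ℝ≥0∞ : Set₁ where
  field
    Below    : ℚ → Set
    negative : ∀ {q} → q <ℚ 0ℚ → Below q
    lower    : ∀ {p q} → p ≤ℚ q → Below q → Below p
    rounded  : ∀ {q} → Below q → ∃ λ r → q <ℚ r × Below r

open ℝ≥0∞

infix  4 _≤_ _≥_
infixl 7 _·_ _÷_

_≤_ _≥_ : ℝ≥0∞ → ℝ≥0∞ → Set
x ≤ y = ∀ {q} → Below x q → Below y q
_≥_ = flip _≤_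

fromℚ : (q : ℚ) → 0ℚ ≤ℚ q → ℝ≥0∞
fromℚ q 0≤q = record
  { Below    = _<ℚ q
  ; negative = λ p<0 → ℚₚ.<-≤-trans p<0 0≤q
  ; lower    = ℚₚ.≤-<-trans
  ; rounded  = ℚₚ.<-dense
  }

_÷_ : (m n : ℕ) .{{_ : NonZero n}} → ℝ≥0∞
m ÷ n = fromℚ (+ m / n) (ℚₚ.nonNegative⁻¹ _ {{ℚₚ.normalize-nonNeg m n}})

-- x · y is the supremum of the products of nonnegative rationals below x and
-- below y, respectively.

_·_ : ℝ≥0∞ → ℝ≥0∞ → ℝ≥0∞
x · y = record
  { Below    = λ q → q <ℚ 0ℚ ⊎ Product q
  ; negative = inj₁
  ; lower    = λ where
      p≤q (inj₁ q<0)                               → inj₁ (ℚₚ.≤-<-trans p≤q q<0)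
      p≤q (inj₂ (r , s , 0≤r , 0≤s , r< , s< , q<)) →
        inj₂ (r , s , 0≤r , 0≤s , r< , s< , ℚₚ.≤-<-trans p≤q q<)
  ; rounded  = λ where
      (inj₁ q<0) → let r , q<r , r<0 = ℚₚ.<-dense q<0 in r , q<r , inj₁ r<0
      (inj₂ (r , s , 0≤r , 0≤s , r< , s< , q<)) →
        let t , q<t , t< = ℚₚ.<-dense q< in
        t , q<t , inj₂ (r , s , 0≤r , 0≤s , r< , s< , t<)
  }
  where
  Product : ℚ → Set
  Product q = Σ ℚ λ r → Σ ℚ λ s →
    0ℚ ≤ℚ r × 0ℚ ≤ℚ s × Below x r × Below y s × q <ℚ r *ℚ s

1ℝ : ℝ≥0∞
1ℝ = 1 ÷ 1

∏ : ∀ {d} → Vec ℝ≥0∞ d → ℝ≥0∞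
∏ []       = 1ℝ
∏ (x ∷ xs) = x · ∏ xs

-- q < limsup a if and only if, for some r > q, infinitely many terms of a
-- are at least r.

limsup : (a : ℕ → ℚ) → (∀ n → 0ℚ ≤ℚ a n) → ℝ≥0∞
limsup a a≥0 = record
  { Below    = λ q → ∃ λ r → q <ℚ r × Frequently r
  ; negative = λ q<0 → 0ℚ , q<0 , λ N → N , ℕₚ.≤-refl , a≥0 N
  ; lower    = λ where p≤q (r , q<r , fr) → r , ℚₚ.≤-<-trans p≤q q<r , fr
  ; rounded  = λ where
      (r , q<r , fr) → let s , q<s , s<r = ℚₚ.<-dense q<r in s , q<s , r , s<r , fr
  }
  where
  Frequently : ℚ → Set
  Frequently r = ∀ N → ∃ λ n → N ℕ.≤ n × r ≤ℚ a n

------------------------------------------------------------------------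
-- Inducibility

I : ℕ → Tree → ℝ≥0∞
I d nothing    = 1ℝ
I d D@(just _) = limsup (maxDensity d D) (maxDensity≥0 d D)

------------------------------------------------------------------------
-- Multinomial coefficients and powers

∏ℕ : ∀ {d} → Vec ℕ d → ℕ
∏ℕ []       = 1
∏ℕ (n ∷ ns) = n ℕ.* ∏ℕ ns

∏!≢0 : ∀ {d} (ks : Vec ℕ d) → NonZero (∏ℕ (Vec.map _! ks))
∏!≢0 []       = _
∏!≢0 (k ∷ ks) = ℕₚ.m*n≢0 (k !) _ {{k ℕₚ.!≢0}} {{∏!≢0 ks}}

multinomial : ∀ {d} → ℕ → Vec ℕ d → ℝ≥0∞
multinomial n ks = (n ! ÷ ∏ℕ (Vec.map _! ks)) {{∏!≢0 ks}}

n^n≢0 : ∀ n → NonZero (n ℕ.^ n)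
n^n≢0 zero      = _
n^n≢0 n@(suc _) = ℕₚ.m^n≢0 n n

{-# OPTIONS --safe #-}

-- Let q be below the right-hand side. It is witnessed by numbers s i below the
-- inducibilities of the branches D i, say with k i leaves, and hence by large
-- trees T i with at least s i (n i)^(k i) / (k i)! copies of D i, where n i is
-- the number of leaves of T i. Replacing every leaf of T i by a caterpillar
-- with m leaves multiplies n i by m and the number of copies by at least
-- m^(k i), so that the estimate persists. Thus we may assume n i = k i P with a
-- common P. In the tree with the branches T i, each choice of a copy of every
-- D i in T i yields a copy of D, and dividing the number of choices by the
-- number of sets of k = Σ k i leaves, which is at most (k P)^k / k!, gives the
-- claim. The sizes n i need no adjustment beyond this because the limit superior
-- asks for infinitely many sizes only.

module Submission where

open import Defs
open import Data.Bool.Base using (true; false; if_then_else_)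
open import Data.Fin.Subset using (Subset; inside; outside; ∣_∣)
open import Data.Integer.Base as ℤ using (+_; -[1+_])
import Data.Integer.Properties as ℤₚ
open import Data.List.Base as List using (List; []; _∷_; _++_; length; filter)
open import Data.List.Membership.Propositional using (_∈_)
open import Data.List.Membership.Propositional.Properties using (∈-map⁺; ∈-map⁻)
import Data.List.Properties as Listₚ
open import Data.List.Relation.Binary.Permutation.Homogeneous as Perm using (Permutation)
open import Data.List.Relation.Binary.Pointwise.Base using (Pointwise; []; _∷_)
import Data.List.Relation.Binary.Pointwise.Properties as Pointwise
open import Data.List.Relation.Unary.All as All using (All; []; _∷_)
open import Data.Maybe.Base as Maybe using (just; nothing)
import Data.Maybe.Relation.Binary.Pointwise as MaybePointwise
import Data.Maybe.Relation.Unary.All as MaybeAll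
open import Data.Nat.Base
  using (ℕ; zero; suc; pred; _+_; _*_; _^_; _∸_; _!; NonZero; >-nonZero; z≤n; s≤s)
  renaming (_≤_ to _≤ℕ_; _<_ to _<ℕ_)
open import Data.Nat.Combinatorics using (_C_; nCk≡nPk/k!; nPk≡n!/[n∸k]!)
open import Data.Nat.Combinatorics.Base using (_P′_)
open import Data.Nat.Combinatorics.Specification using (k!∣nP′k; nP′k≡n!/[n∸k]!)
import Data.Nat.DivMod as DivMod
import Data.Nat.Properties as ℕₚ
open import Data.Nat.Tactic.RingSolver using (solve-∀)
open import Data.Product.Base using (∃; _×_; _,_; proj₂)
open import Data.Rational.Base
  using (ℚ; mkℚ; 0ℚ; 1ℚ; _/_; NonNegative; Positive; nonNegative; *≤*; toℚᵘ)
  renaming (_<_ to _<ℚ_; _≤_ to _≤ℚ_; _*_ to _*ℚ_)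
import Data.Rational.Properties as ℚₚ
open import Data.Rational.Solver using (module +-*-Solver)
open import Data.Rational.Unnormalised.Base as ℚᵘ using (mkℚᵘ; *≡*)
import Data.Rational.Unnormalised.Properties as ℚᵘₚ
open import Data.Sum.Base using (inj₁; inj₂)
open import Data.Vec.Base as Vec using (Vec; []; _∷_; map; take; drop)
open import Function.Base using (_∘_)
open import Level using (0ℓ)
open import Relation.Binary.Bundles using (DecTotalOrder)
open import Relation.Binary.PropositionalEquality
open import Relation.Nullary.Decidable using (Dec; yes; no; does; dec-true; dec-false; _×-dec_)
open import Relation.Nullary.Negation using (contradiction)
open import Relation.Unary using (Pred; Decidable)
open import Data.List.Extrema (DecTotalOrder.totalOrder ℚₚ.≤-decTotalOrder) using (xs≤max; argmax-sel)

open ℝ≥0∞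

-- Indicators of decidable propositions

𝟙 : ∀ {P : Set} → Dec P → ℕ
𝟙 P? = if does P? then 1 else 0

𝟙-cong : ∀ {P Q : Set} (P? : Dec P) (Q? : Dec Q) → (P → Q) → (Q → P) → 𝟙 P? ≡ 𝟙 Q?
𝟙-cong (yes p) Q? f g rewrite dec-true Q? (f p) = refl
𝟙-cong (no ¬p) Q? f g rewrite dec-false Q? (¬p ∘ g) = refl

-- The two factors have to agree only where the indicator is 1; elsewhere both products vanish.
𝟙-*-cong : ∀ {P : Set} (P? : Dec P) {m n} → (P → m ≡ n) → m * 𝟙 P? ≡ n * 𝟙 P?
𝟙-*-cong (yes p) f = cong (_* 1) (f p)
𝟙-*-cong (no ¬p) {m} {n} f = trans (ℕₚ.*-zeroʳ m) (sym (ℕₚ.*-zeroʳ n))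

𝟙-× : ∀ {P Q R : Set} (P? : Dec P) (Q? : Dec Q) (R? : Dec R) → (P → Q → R) → 𝟙 P? * 𝟙 Q? ≤ℕ 𝟙 R?
𝟙-× (no _)  Q?      R? f = z≤n
𝟙-× (yes p) (no _)  R? f = z≤n
𝟙-× (yes p) (yes q) R? f rewrite dec-true R? (f p q) = ℕₚ.≤-refl

-- Sums over all subsets

∑ : ∀ n → (Subset n → ℕ) → ℕ
∑ zero    f = f []
∑ (suc n) f = ∑ n (f ∘ (inside ∷_)) + ∑ n (f ∘ (outside ∷_))

∑-cong : ∀ n {f g : Subset n → ℕ} → (∀ S → f S ≡ g S) → ∑ n f ≡ ∑ n g
∑-cong zero    eq = eq []
∑-cong (suc n) eq = cong₂ _+_ (∑-cong n (eq ∘ _)) (∑-cong n (eq ∘ _))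

∑-mono : ∀ n {f g : Subset n → ℕ} → (∀ S → f S ≤ℕ g S) → ∑ n f ≤ℕ ∑ n g
∑-mono zero    le = le []
∑-mono (suc n) le = ℕₚ.+-mono-≤ (∑-mono n (le ∘ _)) (∑-mono n (le ∘ _))

∑-*ˡ : ∀ n k {f : Subset n → ℕ} → ∑ n (λ S → k * f S) ≡ k * ∑ n f
∑-*ˡ zero    k = refl
∑-*ˡ (suc n) k = trans (cong₂ _+_ (∑-*ˡ n k) (∑-*ˡ n k)) (sym (ℕₚ.*-distribˡ-+ k _ _))

-- A set of leaves of a forest is a pair of sets, one in the first tree and one in the rest. `hull*`
-- cuts it up in this way, so sums over such sets become iterated sums.
∑-take-drop : ∀ m {n} (f : Subset m → Subset n → ℕ) →
              ∑ (m + n) (λ S → f (take m S) (drop m S)) ≡ ∑ m (λ A → ∑ n (f A))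
∑-take-drop zero    f = refl
∑-take-drop (suc m) f = cong₂ _+_ (∑-take-drop m (f ∘ _)) (∑-take-drop m (f ∘ _))

length-filter-map : ∀ {A B : Set} {P : Pred B 0ℓ} (P? : Decidable P) (f : A → B) xs →
  length (filter P? (List.map f xs)) ≡ length (filter (P? ∘ f) xs)
length-filter-map P? f []       = refl
length-filter-map P? f (x ∷ xs) with does (P? (f x))
... | true  = cong suc (length-filter-map P? f xs)
... | false = length-filter-map P? f xs

length-filter-allSubsets : ∀ n {P : Pred (Subset n) 0ℓ} (P? : Decidable P) →
  length (filter P? (allSubsets n)) ≡ ∑ n (𝟙 ∘ P?)
length-filter-allSubsets zero    P? with does (P? [])
... | true  = refl
... | false = refl
length-filter-allSubsets (suc n) P? = begin
  length (filter P? (ins ++ outs))                ≡⟨ cong length (Listₚ.filter-++ P? ins outs) ⟩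
  length (filter P? ins ++ filter P? outs)        ≡⟨ Listₚ.length-++ (filter P? ins) ⟩
  length (filter P? ins) + length (filter P? outs)
    ≡⟨ cong₂ _+_ (length-filter-map P? _ (allSubsets n)) (length-filter-map P? _ (allSubsets n)) ⟩
  length (filter (P? ∘ (inside ∷_)) (allSubsets n)) + length (filter (P? ∘ (outside ∷_)) (allSubsets n))
    ≡⟨ cong₂ _+_ (length-filter-allSubsets n _) (length-filter-allSubsets n _) ⟩
  ∑ (suc n) (𝟙 ∘ P?)                              ∎
  where
  open ≡-Reasoning
  ins  = List.map (inside ∷_) (allSubsets n)
  outs = List.map (outside ∷_) (allSubsets n)

-- Sums over induced trees

induced* : (ts : List Tree⁺) → Subset ‖ ts ‖* → List Tree⁺
induced* ts = suppress* ∘ hull* ts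

-- Suppression commutes with forming a node: no surviving branch leaves nothing, and a single one
-- takes the place of its parent. Hence an induced tree depends only on the induced trees of the
-- branches, which makes every count recursive.
suppressedNode : List Tree⁺ → Tree
suppressedNode []           = nothing
suppressedNode (t ∷ [])     = just t
suppressedNode (t ∷ u ∷ ts) = just (node (t ∷ u ∷ ts))

suppress-join : ∀ ts → Maybe.map suppress (join ts) ≡ suppressedNode (suppress* ts)
suppress-join []           = refl
suppress-join (t ∷ [])     = refl
suppress-join (t ∷ u ∷ ts) = refl

suppress*-++ : ∀ h ts → suppress* (List.fromMaybe h ++ ts) ≡
                        List.fromMaybe (Maybe.map suppress h) ++ suppress* ts
suppress*-++ (just t) ts = refl
suppress*-++ nothing  ts = refl

induced-node : ∀ t ts S → induced (just (node (t ∷ ts))) S ≡ suppressedNode (induced* (t ∷ ts) S)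
induced-node t ts S = suppress-join (hull* (t ∷ ts) S)

induced*-∷ : ∀ t ts S → induced* (t ∷ ts) S ≡
  List.fromMaybe (induced (just t) (take ‖ t ‖⁺ S)) ++ induced* ts (drop ‖ t ‖⁺ S)
induced*-∷ t ts S = suppress*-++ (hull t (take ‖ t ‖⁺ S)) _

-- An arbitrary function of the induced tree is summed, so that in the recursion the contribution of
-- the remaining branches can be absorbed into it.
∑ᵢ : Tree⁺ → (Tree → ℕ) → ℕ
∑ᵢ t f = ∑ ‖ t ‖⁺ (f ∘ induced (just t))

∑ᵢ* : List Tree⁺ → (List Tree⁺ → ℕ) → ℕ
∑ᵢ* ts f = ∑ ‖ ts ‖* (f ∘ induced* ts)

∑ᵢ-node : ∀ t ts f → ∑ᵢ (node (t ∷ ts)) f ≡ ∑ᵢ* (t ∷ ts) (f ∘ suppressedNode)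
∑ᵢ-node t ts f = ∑-cong ‖ t ∷ ts ‖* (cong f ∘ induced-node t ts)

∑ᵢ*-∷ : ∀ t ts f → ∑ᵢ* (t ∷ ts) f ≡ ∑ᵢ t (λ h → ∑ᵢ* ts (λ hs → f (List.fromMaybe h ++ hs)))
∑ᵢ*-∷ t ts f = trans (∑-cong ‖ t ∷ ts ‖* (cong f ∘ induced*-∷ t ts))
  (∑-take-drop ‖ t ‖⁺ (λ A B → f (List.fromMaybe (induced (just t) A) ++ induced* ts B)))

∑ᵢ-mono : ∀ t {f g : Tree → ℕ} → (∀ h → f h ≤ℕ g h) → ∑ᵢ t f ≤ℕ ∑ᵢ t g
∑ᵢ-mono t le = ∑-mono ‖ t ‖⁺ (le ∘ _)

∑ᵢ*-mono : ∀ ts {f g : List Tree⁺ → ℕ} → (∀ hs → f hs ≤ℕ g hs) → ∑ᵢ* ts f ≤ℕ ∑ᵢ* ts g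
∑ᵢ*-mono ts le = ∑-mono ‖ ts ‖* (le ∘ _)

-- Numbers of leaves

‖++‖* : ∀ h ts → ‖ List.fromMaybe h ++ ts ‖* ≡ ‖ h ‖ + ‖ ts ‖*
‖++‖* (just t) ts = refl
‖++‖* nothing  ts = refl

‖suppressedNode‖ : ∀ ts → ‖ suppressedNode ts ‖ ≡ ‖ ts ‖*
‖suppressedNode‖ []           = refl
‖suppressedNode‖ (t ∷ [])     = sym (ℕₚ.+-identityʳ _)
‖suppressedNode‖ (t ∷ u ∷ ts) = refl

∣take∣+∣drop∣ : ∀ m {n} (S : Subset (m + n)) → ∣ take m S ∣ + ∣ drop m S ∣ ≡ ∣ S ∣
∣take∣+∣drop∣ zero    S           = refl
∣take∣+∣drop∣ (suc m) (true  ∷ S) = cong suc (∣take∣+∣drop∣ m S)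
∣take∣+∣drop∣ (suc m) (false ∷ S) = ∣take∣+∣drop∣ m S

mutual
  ‖induced‖ : ∀ t S → ‖ induced (just t) S ‖ ≡ ∣ S ∣
  ‖induced‖ (node [])       (true  ∷ []) = refl
  ‖induced‖ (node [])       (false ∷ []) = refl
  ‖induced‖ (node (t ∷ ts)) S = begin
    ‖ induced (just (node (t ∷ ts))) S ‖        ≡⟨ cong ‖_‖ (induced-node t ts S) ⟩
    ‖ suppressedNode (induced* (t ∷ ts) S) ‖    ≡⟨ ‖suppressedNode‖ (induced* (t ∷ ts) S) ⟩
    ‖ induced* (t ∷ ts) S ‖*                    ≡⟨ ‖induced*‖ (t ∷ ts) S ⟩
    ∣ S ∣                                       ∎
    where open ≡-Reasoning

  ‖induced*‖ : ∀ ts S → ‖ induced* ts S ‖* ≡ ∣ S ∣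
  ‖induced*‖ []       []  = refl
  ‖induced*‖ (t ∷ ts) S = begin
    ‖ induced* (t ∷ ts) S ‖*                         ≡⟨ cong ‖_‖* (induced*-∷ t ts S) ⟩
    ‖ List.fromMaybe h ++ induced* ts (drop ‖ t ‖⁺ S) ‖*  ≡⟨ ‖++‖* h _ ⟩
    ‖ h ‖ + ‖ induced* ts (drop ‖ t ‖⁺ S) ‖*
      ≡⟨ cong₂ _+_ (‖induced‖ t (take ‖ t ‖⁺ S)) (‖induced*‖ ts (drop ‖ t ‖⁺ S)) ⟩
    ∣ take ‖ t ‖⁺ S ∣ + ∣ drop ‖ t ‖⁺ S ∣             ≡⟨ ∣take∣+∣drop∣ ‖ t ‖⁺ S ⟩
    ∣ S ∣                                            ∎
    where
    open ≡-Reasoning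
    h = induced (just t) (take ‖ t ‖⁺ S)

mutual
  ≅⁺⇒‖‖≡ : ∀ {t u} → t ≅⁺ u → ‖ t ‖⁺ ≡ ‖ u ‖⁺
  ≅⁺⇒‖‖≡ {node []}      {node []}      (node p) = refl
  ≅⁺⇒‖‖≡ {node []}      {node (_ ∷ _)} (node p) with () ← ↭-length p
  ≅⁺⇒‖‖≡ {node (_ ∷ _)} {node []}      (node p) with () ← ↭-length p
  ≅⁺⇒‖‖≡ {node (_ ∷ _)} {node (_ ∷ _)} (node p) = ↭⇒‖‖≡ p

  ↭⇒‖‖≡ : ∀ {ts us} → Permutation _≅⁺_ ts us → ‖ ts ‖* ≡ ‖ us ‖*
  ↭⇒‖‖≡ (Perm.refl ps)    = ≅*⇒‖‖≡ ps
  ↭⇒‖‖≡ (Perm.prep p q)   = cong₂ _+_ (≅⁺⇒‖‖≡ p) (↭⇒‖‖≡ q)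
  ↭⇒‖‖≡ (Perm.swap {ys = ys} {x′ = x} {y′ = y} p q r)
    rewrite ≅⁺⇒‖‖≡ p | ≅⁺⇒‖‖≡ q | ↭⇒‖‖≡ r = swap-+ ‖ x ‖⁺ ‖ y ‖⁺ ‖ ys ‖*
    where
    swap-+ : ∀ a b c → a + (b + c) ≡ b + (a + c)
    swap-+ = solve-∀
  ↭⇒‖‖≡ (Perm.trans p q)  = trans (↭⇒‖‖≡ p) (↭⇒‖‖≡ q)

  ≅*⇒‖‖≡ : ∀ {ts us} → Pointwise _≅⁺_ ts us → ‖ ts ‖* ≡ ‖ us ‖*
  ≅*⇒‖‖≡ []       = refl
  ≅*⇒‖‖≡ (p ∷ ps) = cong₂ _+_ (≅⁺⇒‖‖≡ p) (≅*⇒‖‖≡ ps)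

  ↭-length : ∀ {ts us} → Permutation _≅⁺_ ts us → length ts ≡ length us
  ↭-length (Perm.refl ps)    = Pointwise.Pointwise-length ps
  ↭-length (Perm.prep p q)   = cong suc (↭-length q)
  ↭-length (Perm.swap p q r) = cong (suc ∘ suc) (↭-length r)
  ↭-length (Perm.trans p q)  = trans (↭-length p) (↭-length q)

≅⇒‖‖≡ : ∀ {T U} → T ≅ U → ‖ T ‖ ≡ ‖ U ‖
≅⇒‖‖≡ (MaybePointwise.just p) = ≅⁺⇒‖‖≡ p
≅⇒‖‖≡ MaybePointwise.nothing  = refl

-- Copies

copies : Tree → Tree⁺ → ℕ
copies D t = ∑ᵢ t (λ h → 𝟙 (h ≅? D))

-- Neither hull nor suppression loses an element of the set, so an isomorphism with `D` yields the
-- cardinality that `c` asks for.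
c≡copies : ∀ D t → c D (just t) ≡ copies D t
c≡copies D t = trans (length-filter-allSubsets ‖ t ‖⁺ _) (∑-cong ‖ t ‖⁺ (λ S →
  𝟙-cong ((∣ S ∣ ℕₚ.≟ ‖ D ‖) ×-dec (induced (just t) S ≅? D)) (induced (just t) S ≅? D)
    proj₂ (λ p → trans (sym (‖induced‖ t S)) (≅⇒‖‖≡ p) , p)))

_≅*?_ : ∀ ts us → Dec (Pointwise _≅⁺_ ts us)
_≅*?_ = Pointwise.decidable _≅⁺?_

-- Branches are matched in a fixed order. This may miss copies that permute the branches, but a
-- lower bound is enough, and no set is counted twice.
copies* : List Tree⁺ → List Tree⁺ → ℕ
copies* us ts = ∑ᵢ* ts (λ hs → 𝟙 (hs ≅*? us))

-- A copy of `u` in `t` and copies of `us` in `ts` are chosen independently. Equality can fail,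
-- since the copy of `u` may also come from `ts` when `t` contributes nothing.
copies*-∷ : ∀ u us t ts → copies (just u) t * copies* us ts ≤ℕ copies* (u ∷ us) (t ∷ ts)
copies*-∷ u us t ts = begin
  copies (just u) t * copies* us ts
    ≡⟨ ℕₚ.*-comm (copies (just u) t) _ ⟩
  copies* us ts * copies (just u) t
    ≡⟨ ∑-*ˡ ‖ t ‖⁺ (copies* us ts) ⟨
  ∑ᵢ t (λ h → copies* us ts * 𝟙 (h ≅? just u))
    ≤⟨ ∑ᵢ-mono t split ⟩
  ∑ᵢ t (λ h → ∑ᵢ* ts (λ hs → 𝟙 ((List.fromMaybe h ++ hs) ≅*? (u ∷ us))))
    ≡⟨ ∑ᵢ*-∷ t ts (λ hs → 𝟙 (hs ≅*? (u ∷ us))) ⟨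
  copies* (u ∷ us) (t ∷ ts) ∎
  where
  open ℕₚ.≤-Reasoning
  split : ∀ h → copies* us ts * 𝟙 (h ≅? just u) ≤ℕ
                ∑ᵢ* ts (λ hs → 𝟙 ((List.fromMaybe h ++ hs) ≅*? (u ∷ us)))
  split nothing = ℕₚ.≤-trans (ℕₚ.≤-reflexive (ℕₚ.*-zeroʳ (copies* us ts))) z≤n
  split (just x) = begin
    copies* us ts * 𝟙 (just x ≅? just u)              ≡⟨ ∑-*ˡ-comm ⟨
    ∑ᵢ* ts (λ hs → 𝟙 (just x ≅? just u) * 𝟙 (hs ≅*? us)) ≤⟨ ∑ᵢ*-mono ts both ⟩
    ∑ᵢ* ts (λ hs → 𝟙 ((x ∷ hs) ≅*? (u ∷ us)))         ∎
    where
    ∑-*ˡ-comm : ∑ᵢ* ts (λ hs → 𝟙 (just x ≅? just u) * 𝟙 (hs ≅*? us)) ≡ copies* us ts * 𝟙 (just x ≅? just u)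
    ∑-*ˡ-comm = trans (∑-*ˡ ‖ ts ‖* (𝟙 (just x ≅? just u))) (ℕₚ.*-comm _ (copies* us ts))
    both : ∀ hs → 𝟙 (just x ≅? just u) * 𝟙 (hs ≅*? us) ≤ℕ 𝟙 ((x ∷ hs) ≅*? (u ∷ us))
    both hs = 𝟙-× (just x ≅? just u) (hs ≅*? us) ((x ∷ hs) ≅*? (u ∷ us))
      λ { (MaybePointwise.just p) ps → p ∷ ps }

‖node‖⁺ : ∀ ts → 2 ≤ℕ length ts → ‖ node ts ‖⁺ ≡ ‖ ts ‖*
‖node‖⁺ (_ ∷ _) _ = refl

-- With at least two branches matched, `suppressedNode` keeps the root, so the matching of the
-- branches is an isomorphism of the whole induced tree.
copies*≤copies : ∀ us ts → 2 ≤ℕ length us → 2 ≤ℕ length ts →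
                 copies* us ts ≤ℕ copies (just (node us)) (node ts)
copies*≤copies us ts@(t ∷ ts′) 2≤ _ = ℕₚ.≤-trans (∑ᵢ*-mono ts go)
    (ℕₚ.≤-reflexive (sym (∑ᵢ-node t ts′ (λ h → 𝟙 (h ≅? just (node us))))))
  where
  go : ∀ hs → 𝟙 (hs ≅*? us) ≤ℕ 𝟙 (suppressedNode hs ≅? just (node us))
  go hs with hs ≅*? us
  ... | no _ = z≤n
  ... | yes p = ℕₚ.≤-reflexive (sym (cong (λ b → if b then 1 else 0) (dec-true (_ ≅? _) (lemma 2≤ p))))
    where
    lemma : ∀ {hs us} → 2 ≤ℕ length us → Pointwise _≅⁺_ hs us → suppressedNode hs ≅ just (node us)
    lemma _ ps@(_ ∷ _ ∷ _) = MaybePointwise.just (node (Perm.refl ps))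
    lemma (s≤s ()) (_ ∷ [])

-- Replacing every leaf by a caterpillar

-- The index is one less than the number of leaves, so no caterpillar is empty. All of them are
-- binary, hence admissible for every `d` that is at least 2.
caterpillar : ℕ → Tree⁺
caterpillar zero    = node []
caterpillar (suc m) = node (node [] ∷ caterpillar m ∷ [])

mutual
  blowUp : ℕ → Tree⁺ → Tree⁺
  blowUp m (node [])       = caterpillar m
  blowUp m (node (t ∷ ts)) = node (blowUp m t ∷ blowUp* m ts)

  blowUp* : ℕ → List Tree⁺ → List Tree⁺
  blowUp* m []       = []
  blowUp* m (t ∷ ts) = blowUp m t ∷ blowUp* m ts

‖caterpillar‖ : ∀ m → ‖ caterpillar m ‖⁺ ≡ suc m
‖caterpillar‖ zero    = refl
‖caterpillar‖ (suc m) = cong suc (trans (ℕₚ.+-identityʳ _) (‖caterpillar‖ m))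

mutual
  ‖blowUp‖ : ∀ m t → ‖ blowUp m t ‖⁺ ≡ ‖ t ‖⁺ * suc m
  ‖blowUp‖ m (node [])       = trans (‖caterpillar‖ m) (sym (ℕₚ.*-identityˡ _))
  ‖blowUp‖ m (node (t ∷ ts)) = ‖blowUp*‖ m (t ∷ ts)

  ‖blowUp*‖ : ∀ m ts → ‖ blowUp* m ts ‖* ≡ ‖ ts ‖* * suc m
  ‖blowUp*‖ m []       = refl
  ‖blowUp*‖ m (t ∷ ts) = trans (cong₂ _+_ (‖blowUp‖ m t) (‖blowUp*‖ m ts))
    (sym (ℕₚ.*-distribʳ-+ (suc m) ‖ t ‖⁺ _))

length-blowUp* : ∀ m ts → length (blowUp* m ts) ≡ length ts
length-blowUp* m []       = refl
length-blowUp* m (t ∷ ts) = cong suc (length-blowUp* m ts)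

module _ {d} (2≤d : 2 ≤ℕ d) (m : ℕ) where

  caterpillar-dary : ∀ m → Dary⁺ d (caterpillar m)
  caterpillar-dary zero    = leaf
  caterpillar-dary (suc m) = node ℕₚ.≤-refl 2≤d (leaf ∷ caterpillar-dary m ∷ [])

  mutual
    blowUp-dary : ∀ {t} → Dary⁺ d t → Dary⁺ d (blowUp m t)
    blowUp-dary leaf = caterpillar-dary m
    blowUp-dary {node ts@(_ ∷ us)} (node 2≤ ≤d ps) =
      node (subst (2 ≤ℕ_) (sym (length-blowUp* m ts)) 2≤)
           (subst (_≤ℕ d) (sym (length-blowUp* m ts)) ≤d) (blowUp*-dary ps)

    blowUp*-dary : ∀ {ts} → All (Dary⁺ d) ts → All (Dary⁺ d) (blowUp* m ts)
    blowUp*-dary []       = []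
    blowUp*-dary (p ∷ ps) = blowUp-dary p ∷ blowUp*-dary ps

-- Only the empty set and the `suc m` singletons are kept. Each singleton induces a single vertex,
-- and the discarded terms are natural numbers.
∑ᵢ-caterpillar : ∀ m f → suc m * f (just (node [])) + f nothing ≤ℕ ∑ᵢ (caterpillar m) f
∑ᵢ-caterpillar zero    f = ℕₚ.≤-reflexive (cong (_+ f nothing) (ℕₚ.+-identityʳ _))
∑ᵢ-caterpillar (suc m) f = begin
  (x + suc m * x) + f nothing   ≡⟨ ℕₚ.+-assoc x _ _ ⟩
  x + (suc m * x + f nothing)
    -- If the top leaf is chosen, only the empty choice further down is kept, which gives the
    -- summand `x`; if it is not, the induction hypothesis gives the other summands.
    ≤⟨ ℕₚ.+-mono-≤ (ℕₚ.≤-trans (ℕₚ.m≤n+m x (suc m * g (just (node [])) (just (node [])))) (∑ᵢ-caterpillar m (g (just (node [])))))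
         (∑ᵢ-caterpillar m (g nothing)) ⟩
  ∑ᵢ (caterpillar m) (g (just (node []))) + ∑ᵢ (caterpillar m) (g nothing)
    ≡⟨ cong₂ _+_ (∑ᵢ*-∷ (caterpillar m) [] (f′ (just (node [])))) (∑ᵢ*-∷ (caterpillar m) [] (f′ nothing)) ⟨
  ∑ᵢ (node []) (λ h → ∑ᵢ* (caterpillar m ∷ []) (f′ h))
    ≡⟨ ∑ᵢ*-∷ (node []) (caterpillar m ∷ []) (f ∘ suppressedNode) ⟨
  ∑ᵢ* (node [] ∷ caterpillar m ∷ []) (f ∘ suppressedNode)
    ≡⟨ ∑ᵢ-node (node []) (caterpillar m ∷ []) f ⟨
  ∑ᵢ (caterpillar (suc m)) f  ∎
  where
  open ℕₚ.≤-Reasoning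
  x = f (just (node []))
  f′ : Tree → List Tree⁺ → ℕ
  f′ h hs = f (suppressedNode (List.fromMaybe h ++ hs))
  g : Tree → Tree → ℕ
  g h h′ = ∑ᵢ* [] (λ hs → f′ h (List.fromMaybe h′ ++ hs))

-- Choosing one leaf in each of the caterpillars that replace the elements of a
-- set of leaves does not change the induced tree.

mutual
  ∑ᵢ-blowUp : ∀ m t f → ∑ᵢ t (λ h → suc m ^ ‖ h ‖ * f h) ≤ℕ ∑ᵢ (blowUp m t) f
  ∑ᵢ-blowUp m (node []) f = ℕₚ.≤-trans
    (ℕₚ.≤-reflexive (cong₂ _+_ (cong (_* f (just (node []))) (ℕₚ.*-identityʳ (suc m))) (ℕₚ.+-identityʳ _)))
    (∑ᵢ-caterpillar m f)
  ∑ᵢ-blowUp m (node (t ∷ ts)) f = begin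
    ∑ᵢ (node (t ∷ ts)) (λ h → suc m ^ ‖ h ‖ * f h)
      ≡⟨ ∑ᵢ-node t ts (λ h → suc m ^ ‖ h ‖ * f h) ⟩
    ∑ᵢ* (t ∷ ts) (λ hs → suc m ^ ‖ suppressedNode hs ‖ * f (suppressedNode hs))
      ≡⟨ ∑-cong ‖ t ∷ ts ‖* (λ S → cong (λ k → suc m ^ k * f (suppressedNode (induced* (t ∷ ts) S)))
           (‖suppressedNode‖ (induced* (t ∷ ts) S))) ⟩
    ∑ᵢ* (t ∷ ts) (λ hs → suc m ^ ‖ hs ‖* * f (suppressedNode hs))
      ≤⟨ ∑ᵢ*-blowUp* m (t ∷ ts) (f ∘ suppressedNode) ⟩
    ∑ᵢ* (blowUp* m (t ∷ ts)) (f ∘ suppressedNode)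
      ≡⟨ ∑ᵢ-node (blowUp m t) (blowUp* m ts) f ⟨
    ∑ᵢ (blowUp m (node (t ∷ ts))) f ∎
    where open ℕₚ.≤-Reasoning

  ∑ᵢ*-blowUp* : ∀ m ts f → ∑ᵢ* ts (λ hs → suc m ^ ‖ hs ‖* * f hs) ≤ℕ ∑ᵢ* (blowUp* m ts) f
  ∑ᵢ*-blowUp* m []       f = ℕₚ.≤-reflexive (ℕₚ.+-identityʳ _)
  ∑ᵢ*-blowUp* m (t ∷ ts) f = begin
    ∑ᵢ* (t ∷ ts) (λ hs → suc m ^ ‖ hs ‖* * f hs)
      ≡⟨ ∑ᵢ*-∷ t ts (λ hs → suc m ^ ‖ hs ‖* * f hs) ⟩
    ∑ᵢ t (λ h → ∑ᵢ* ts (λ hs → suc m ^ ‖ List.fromMaybe h ++ hs ‖* * f (List.fromMaybe h ++ hs)))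
      ≡⟨ ∑-cong ‖ t ‖⁺ (λ S → trans (∑-cong ‖ ts ‖* (λ S′ → split (induced (just t) S) (induced* ts S′)))
           (∑-*ˡ ‖ ts ‖* (suc m ^ ‖ induced (just t) S ‖))) ⟩
    ∑ᵢ t (λ h → suc m ^ ‖ h ‖ * ∑ᵢ* ts (λ hs → suc m ^ ‖ hs ‖* * f (List.fromMaybe h ++ hs)))
      -- First `t` is blown up, the sum over `ts` being a function of `h`; then `ts` is blown up for
      -- each fixed `h`.
      ≤⟨ ∑ᵢ-blowUp m t (λ h → ∑ᵢ* ts (λ hs → suc m ^ ‖ hs ‖* * f (List.fromMaybe h ++ hs))) ⟩
    ∑ᵢ (blowUp m t) (λ h → ∑ᵢ* ts (λ hs → suc m ^ ‖ hs ‖* * f (List.fromMaybe h ++ hs)))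
      ≤⟨ ∑ᵢ-mono (blowUp m t) (λ h → ∑ᵢ*-blowUp* m ts (λ hs → f (List.fromMaybe h ++ hs))) ⟩
    ∑ᵢ (blowUp m t) (λ h → ∑ᵢ* (blowUp* m ts) (λ hs → f (List.fromMaybe h ++ hs)))
      ≡⟨ ∑ᵢ*-∷ (blowUp m t) (blowUp* m ts) f ⟨
    ∑ᵢ* (blowUp* m (t ∷ ts)) f ∎
    where
    open ℕₚ.≤-Reasoning
    split : ∀ h hs → suc m ^ ‖ List.fromMaybe h ++ hs ‖* * f (List.fromMaybe h ++ hs) ≡
                     suc m ^ ‖ h ‖ * (suc m ^ ‖ hs ‖* * f (List.fromMaybe h ++ hs))
    split h hs = trans (cong (_* _) (trans (cong (suc m ^_) (‖++‖* h hs)) (ℕₚ.^-distribˡ-+-* (suc m) ‖ h ‖ _)))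
      (ℕₚ.*-assoc (suc m ^ ‖ h ‖) _ _)

-- The weight in `∑ᵢ-blowUp` is constant on the copies of `D`, as isomorphic trees have equally many
-- leaves.
copies-blowUp : ∀ m D t → suc m ^ ‖ D ‖ * copies D t ≤ℕ copies D (blowUp m t)
copies-blowUp m D t = ℕₚ.≤-trans
  (ℕₚ.≤-reflexive (trans (sym (∑-*ˡ ‖ t ‖⁺ (suc m ^ ‖ D ‖))) (∑-cong ‖ t ‖⁺ λ S →
    𝟙-*-cong (induced (just t) S ≅? D) (cong (suc m ^_) ∘ sym ∘ ≅⇒‖‖≡))))
  (∑ᵢ-blowUp m t (λ h → 𝟙 (h ≅? D)))

copies*-blowUp* : ∀ m us ts → suc m ^ ‖ us ‖* * copies* us ts ≤ℕ copies* us (blowUp* m ts)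
copies*-blowUp* m us ts = ℕₚ.≤-trans
  (ℕₚ.≤-reflexive (trans (sym (∑-*ˡ ‖ ts ‖* (suc m ^ ‖ us ‖*))) (∑-cong ‖ ts ‖* λ S →
    𝟙-*-cong (induced* ts S ≅*? us) (cong (suc m ^_) ∘ sym ∘ ≅*⇒‖‖≡))))
  (∑ᵢ*-blowUp* m ts (λ hs → 𝟙 (hs ≅*? us)))

-- Binomial coefficients and powers

k!*nCk≡nP′k : ∀ {n k} → k ≤ℕ n → k ! * (n C k) ≡ n P′ k
k!*nCk≡nP′k {n} {k} k≤n = begin
  k ! * (n C k)
    ≡⟨ cong (k ! *_) (trans (nCk≡nPk/k! k≤n)
         (cong (DivMod._/ (k !)) (trans (nPk≡n!/[n∸k]! k≤n) (sym (nP′k≡n!/[n∸k]! k≤n))))) ⟩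
  k ! * ((n P′ k) DivMod./ k !)
    ≡⟨ DivMod.m*[n/m]≡n (k!∣nP′k k≤n) ⟩
  n P′ k  ∎
  where
  open ≡-Reasoning
  instance _ = k ℕₚ.!≢0

^-distribʳ-* : ∀ k m n → (m * n) ^ k ≡ m ^ k * n ^ k
^-distribʳ-* zero    m n = refl
^-distribʳ-* (suc k) m n = trans (cong (m * n *_) (^-distribʳ-* k m n)) (regroup m n (m ^ k) (n ^ k))
  where
  regroup : ∀ m n p q → m * n * (p * q) ≡ m * p * (n * q)
  regroup = solve-∀

nP′k≤n^k : ∀ n k → n P′ k ≤ℕ n ^ k
nP′k≤n^k n zero    = ℕₚ.≤-refl
nP′k≤n^k n (suc k) = ℕₚ.*-mono-≤ (ℕₚ.m∸n≤m n k) (nP′k≤n^k n k)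

k!*nCk≤n^k : ∀ {n k} → k ≤ℕ n → k ! * (n C k) ≤ℕ n ^ k
k!*nCk≤n^k {n} {k} k≤n = subst (_≤ℕ n ^ k) (sym (k!*nCk≡nP′k k≤n)) (nP′k≤n^k n k)

nP′k≢0 : ∀ {n k} → k ≤ℕ n → NonZero (n P′ k)
nP′k≢0 {k = zero}      _   = _
nP′k≢0 {n} {suc k} k<n = ℕₚ.m*n≢0 (n ∸ k) (n P′ k)
  {{>-nonZero (ℕₚ.m<n⇒0<n∸m k<n)}} {{nP′k≢0 (ℕₚ.<⇒≤ k<n)}}

nCk≢0 : ∀ {n k} → k ≤ℕ n → NonZero (n C k)
nCk≢0 {n} {k} k≤n = ℕₚ.m*n≢0⇒n≢0 (k !) {{subst NonZero (sym (k!*nCk≡nP′k k≤n)) (nP′k≢0 k≤n)}}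

-- With denominators cleared, this says that the product of 1 - i/n over i < k is at least 1 - k²/n.
-- The next factor costs at most k/n, and k² + k is at most (k + 1)².
n*n^k≤n*nP′k+k²*n^k : ∀ n k → n * n ^ k ≤ℕ n * (n P′ k) + k * k * n ^ k
n*n^k≤n*nP′k+k²*n^k n zero    = ℕₚ.m≤m+n _ _
n*n^k≤n*nP′k+k²*n^k n (suc k) = begin
  n * (n * n ^ k)
    ≤⟨ ℕₚ.*-monoʳ-≤ n (n*n^k≤n*nP′k+k²*n^k n k) ⟩
  n * (n * (n P′ k) + k * k * n ^ k)
    ≡⟨ step₁ n (n P′ k) k (n ^ k) ⟩
  n * (n * (n P′ k)) + k * k * (n * n ^ k)
    ≤⟨ ℕₚ.+-monoˡ-≤ _ (ℕₚ.*-monoʳ-≤ n (ℕₚ.*-monoˡ-≤ (n P′ k) (ℕₚ.m≤n+m∸n n k))) ⟩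
  n * ((k + (n ∸ k)) * (n P′ k)) + k * k * (n * n ^ k)
    ≡⟨ step₂ n k (n ∸ k) (n P′ k) (n * n ^ k) ⟩
  n * ((n ∸ k) * (n P′ k)) + (n * (k * (n P′ k)) + k * k * (n * n ^ k))
    ≤⟨ ℕₚ.+-monoʳ-≤ (n * ((n ∸ k) * (n P′ k))) (ℕₚ.+-monoˡ-≤ _
         (ℕₚ.*-monoʳ-≤ n (ℕₚ.*-monoʳ-≤ k (nP′k≤n^k n k)))) ⟩
  n * ((n ∸ k) * (n P′ k)) + (n * (k * n ^ k) + k * k * (n * n ^ k))
    ≤⟨ ℕₚ.+-monoʳ-≤ (n * ((n ∸ k) * (n P′ k))) (ℕₚ.m≤m+n _ (suc k * (n * n ^ k))) ⟩
  n * ((n ∸ k) * (n P′ k)) + (n * (k * n ^ k) + k * k * (n * n ^ k) + suc k * (n * n ^ k))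
    ≡⟨ cong₂ _+_ {x = n * ((n ∸ k) * (n P′ k))} refl (step₃ n k (n ^ k)) ⟩
  n * ((n ∸ k) * (n P′ k)) + suc k * suc k * (n * n ^ k) ∎
  where
  open ℕₚ.≤-Reasoning
  step₁ : ∀ n p k q → n * (n * p + k * k * q) ≡ n * (n * p) + k * k * (n * q)
  step₁ = solve-∀
  step₂ : ∀ n k m p q → n * ((k + m) * p) + k * k * q ≡ n * (m * p) + (n * (k * p) + k * k * q)
  step₂ = solve-∀
  step₃ : ∀ n k q → n * (k * q) + k * k * (n * q) + suc k * (n * q) ≡ suc k * suc k * (n * q)
  step₃ = solve-∀

-- For `n` this large, the error term of the preceding estimate, multiplied by `suc x`, is at most
-- `n * n ^ k`, which is exactly the surplus of the factor `suc x` over `x`.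
x*n^k≤[1+x]*nP′k : ∀ x n k → .{{NonZero n}} → suc x * (k * k) ≤ℕ n → x * n ^ k ≤ℕ suc x * (n P′ k)
x*n^k≤[1+x]*nP′k x n k ≤n = ℕₚ.*-cancelˡ-≤ n (ℕₚ.+-cancelʳ-≤ (n * n ^ k) _ _ (begin
  n * (x * n ^ k) + n * n ^ k             ≡⟨ step₁ n x (n ^ k) ⟩
  suc x * (n * n ^ k)                     ≤⟨ ℕₚ.*-monoʳ-≤ (suc x) (n*n^k≤n*nP′k+k²*n^k n k) ⟩
  suc x * (n * (n P′ k) + k * k * n ^ k)    ≡⟨ step₂ x n (n P′ k) (k * k) (n ^ k) ⟩
  n * (suc x * (n P′ k)) + suc x * (k * k) * n ^ k ≤⟨ ℕₚ.+-monoʳ-≤ _ (ℕₚ.*-monoˡ-≤ (n ^ k) ≤n) ⟩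
  n * (suc x * (n P′ k)) + n * n ^ k        ∎))
  where
  open ℕₚ.≤-Reasoning
  step₁ : ∀ n x q → n * (x * q) + n * q ≡ suc x * (n * q)
  step₁ = solve-∀
  step₂ : ∀ x n p k q → suc x * (n * p + k * q) ≡ n * (suc x * p) + suc x * k * q
  step₂ = solve-∀

-- Rational numbers

-- Kept opaque so that the normalisation of fractions is not unfolded outside the next block, which
-- proves the laws used later.
opaque

  ι : ℕ → ℚ
  ι n = + n / 1

opaque
  unfolding ι

  ι≡/1 : ∀ n → ι n ≡ + n / 1
  ι≡/1 n = refl

  ι-0 : ι 0 ≡ 0ℚ
  ι-0 = refl

  ι-1 : ι 1 ≡ 1ℚ
  ι-1 = refl

  ι-nonNeg : ∀ n → NonNegative (ι n)
  ι-nonNeg n = ℚₚ.normalize-nonNeg n 1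

  ι-pos : ∀ n → .{{NonZero n}} → Positive (ι n)
  ι-pos n = ℚₚ.normalize-pos n 1

  /-*-cancel : ∀ m n .{{_ : NonZero n}} → (+ m / n) *ℚ ι n ≡ ι m
  /-*-cancel m n@(suc n-1) = ℚₚ.toℚᵘ-injective (begin
    toℚᵘ ((+ m / n) *ℚ ι n)          ≈⟨ ℚₚ.toℚᵘ-homo-* (+ m / n) (ι n) ⟩
    toℚᵘ (+ m / n) ℚᵘ.* toℚᵘ (ι n)
      ≈⟨ ℚᵘₚ.*-cong (ℚₚ.toℚᵘ-fromℚᵘ (mkℚᵘ (+ m) n-1)) (ℚₚ.toℚᵘ-fromℚᵘ (mkℚᵘ (+ n) 0)) ⟩
    mkℚᵘ (+ m) n-1 ℚᵘ.* mkℚᵘ (+ n) 0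
      ≈⟨ *≡* (trans (ℤₚ.*-identityʳ (+ m ℤ.* + n)) (cong (λ k → + m ℤ.* + k) (sym (ℕₚ.*-identityʳ n)))) ⟩
    mkℚᵘ (+ m) 0                     ≈⟨ ℚₚ.toℚᵘ-fromℚᵘ (mkℚᵘ (+ m) 0) ⟨
    toℚᵘ (ι m)                       ∎)
    where open ℚᵘₚ.≃-Reasoning

  ι-* : ∀ m n → ι (m * n) ≡ ι m *ℚ ι n
  ι-* m n = ℚₚ.toℚᵘ-injective (begin
    toℚᵘ (ι (m * n))                  ≈⟨ ℚₚ.toℚᵘ-fromℚᵘ (mkℚᵘ (+ (m * n)) 0) ⟩
    mkℚᵘ (+ (m * n)) 0                ≡⟨ cong (λ i → mkℚᵘ i 0) (ℤₚ.pos-* m n) ⟩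
    mkℚᵘ (+ m) 0 ℚᵘ.* mkℚᵘ (+ n) 0
      ≈⟨ ℚᵘₚ.*-cong (ℚₚ.toℚᵘ-fromℚᵘ (mkℚᵘ (+ m) 0)) (ℚₚ.toℚᵘ-fromℚᵘ (mkℚᵘ (+ n) 0)) ⟨
    toℚᵘ (ι m) ℚᵘ.* toℚᵘ (ι n)        ≈⟨ ℚₚ.toℚᵘ-homo-* (ι m) (ι n) ⟨
    toℚᵘ (ι m *ℚ ι n)                 ∎)
    where open ℚᵘₚ.≃-Reasoning

  ι-mono : ∀ {m n} → m ≤ℕ n → ι m ≤ℚ ι n
  ι-mono {m} {n} m≤n = ℚₚ.toℚᵘ-cancel-≤ (begin
    toℚᵘ (ι m)    ≃⟨ ℚₚ.toℚᵘ-fromℚᵘ (mkℚᵘ (+ m) 0) ⟩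
    mkℚᵘ (+ m) 0  ≤⟨ ℚᵘ.*≤* (ℤₚ.*-monoʳ-≤-nonNeg (+ 1) (ℤ.+≤+ m≤n)) ⟩
    mkℚᵘ (+ n) 0  ≃⟨ ℚₚ.toℚᵘ-fromℚᵘ (mkℚᵘ (+ n) 0) ⟨
    toℚᵘ (ι n)    ∎)
    where open ℚᵘₚ.≤-Reasoning

0≤ι : ∀ n → 0ℚ ≤ℚ ι n
0≤ι n = ℚₚ.nonNegative⁻¹ (ι n) {{ι-nonNeg n}}

*-monoʳ-≤-ι : ∀ n {p q} → p ≤ℚ q → p *ℚ ι n ≤ℚ q *ℚ ι n
*-monoʳ-≤-ι n = ℚₚ.*-monoʳ-≤-nonNeg (ι n) {{ι-nonNeg n}}

*-monoˡ-≤-ι : ∀ n {p q} → p ≤ℚ q → ι n *ℚ p ≤ℚ ι n *ℚ q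
*-monoˡ-≤-ι n = ℚₚ.*-monoˡ-≤-nonNeg (ι n) {{ι-nonNeg n}}

*-cancelʳ-≤-ι : ∀ n .{{_ : NonZero n}} {p q} → p *ℚ ι n ≤ℚ q *ℚ ι n → p ≤ℚ q
*-cancelʳ-≤-ι n = ℚₚ.*-cancelʳ-≤-pos (ι n) {{ι-pos n}}

ι-cancel-< : ∀ {m n} → ι m <ℚ ι n → m <ℕ n
ι-cancel-< m<n = ℕₚ.≰⇒> λ n≤m → ℚₚ.<-irrefl refl (ℚₚ.<-≤-trans m<n (ι-mono n≤m))

*-mono-≤ : ∀ {p q r s} → 0ℚ ≤ℚ q → 0ℚ ≤ℚ r → p ≤ℚ q → r ≤ℚ s → p *ℚ r ≤ℚ q *ℚ s
*-mono-≤ {q = q} {r} 0≤q 0≤r p≤q r≤s = ℚₚ.≤-trans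
  (ℚₚ.*-monoʳ-≤-nonNeg r {{nonNegative 0≤r}} p≤q)
  (ℚₚ.*-monoˡ-≤-nonNeg q {{nonNegative 0≤q}} r≤s)

0≤* : ∀ {p q} → 0ℚ ≤ℚ p → 0ℚ ≤ℚ q → 0ℚ ≤ℚ p *ℚ q
0≤* {p} {q} 0≤p 0≤q = ℚₚ.nonNegative⁻¹ (p *ℚ q)
  {{ℚₚ.nonNeg*nonNeg⇒nonNeg p {{nonNegative 0≤p}} q {{nonNegative 0≤q}}}}

≤/⇒*≤ : ∀ {p m n} .{{_ : NonZero n}} → p ≤ℚ + m / n → p *ℚ ι n ≤ℚ ι m
≤/⇒*≤ {p} {m} {n} p≤ = subst (p *ℚ ι n ≤ℚ_) (/-*-cancel m n) (*-monoʳ-≤-ι n p≤)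

≤ratio⇒*≤ : ∀ {p m} n → p ≤ℚ ratio m n → p *ℚ ι n ≤ℚ ι m
≤ratio⇒*≤ {p} {m} zero    _  = subst (_≤ℚ ι m) (sym (trans (cong (p *ℚ_) ι-0) (ℚₚ.*-zeroʳ p))) (0≤ι m)
≤ratio⇒*≤ {m = m} (suc n) p≤ = ≤/⇒*≤ {m = m} p≤

*≤⇒≤ratio : ∀ {p m} n .{{_ : NonZero n}} → p *ℚ ι n ≤ℚ ι m → p ≤ℚ ratio m n
*≤⇒≤ratio {p} {m} n@(suc _) p≤ = *-cancelʳ-≤-ι n
  (subst (p *ℚ ι n ≤ℚ_) (sym (/-*-cancel m n)) p≤)

fraction : ∀ {p} → 0ℚ ≤ℚ p → ∃ λ m → ∃ λ n → NonZero n × p *ℚ ι n ≡ ι m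
fraction {p@(mkℚ (+ m) n-1 _)} _ =
  m , suc n-1 , _ , trans (cong (_*ℚ ι (suc n-1)) (sym (ℚₚ.↥p/↧p≡p p))) (/-*-cancel m (suc n-1))
fraction {mkℚ -[1+ _ ] _ _} (*≤* ())

-- Over a common denominator the numerators are integers, so the gap between `p` and `q` is at least
-- one unit, from `m` to `suc m`.
commonDenominator : ∀ {p q} → 0ℚ ≤ℚ p → p <ℚ q →
                    ∃ λ m → ∃ λ n → NonZero n × p *ℚ ι n ≡ ι m × ι (suc m) ≤ℚ q *ℚ ι n
commonDenominator {p} {q} 0≤p p<q
  with mp , np , np≢0 , eqp ← fraction 0≤p
     | mq , nq , nq≢0 , eqq ← fraction (ℚₚ.<⇒≤ (ℚₚ.≤-<-trans 0≤p p<q))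
  = mp * nq , np * nq , n≢0 , p*n≡ , ℚₚ.≤-trans (ι-mono m<) (ℚₚ.≤-reflexive (sym q*n≡))
  where
  n≢0 = ℕₚ.m*n≢0 np nq {{np≢0}} {{nq≢0}}
  p*n≡ : p *ℚ ι (np * nq) ≡ ι (mp * nq)
  p*n≡ = begin
    p *ℚ ι (np * nq)        ≡⟨ cong (p *ℚ_) (ι-* np nq) ⟩
    p *ℚ (ι np *ℚ ι nq)     ≡⟨ ℚₚ.*-assoc p _ _ ⟨
    p *ℚ ι np *ℚ ι nq       ≡⟨ cong (_*ℚ ι nq) eqp ⟩
    ι mp *ℚ ι nq            ≡⟨ ι-* mp nq ⟨
    ι (mp * nq)             ∎
    where open ≡-Reasoning
  q*n≡ : q *ℚ ι (np * nq) ≡ ι (mq * np)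
  q*n≡ = begin
    q *ℚ ι (np * nq)        ≡⟨ cong (q *ℚ_) (trans (cong ι (ℕₚ.*-comm np nq)) (ι-* nq np)) ⟩
    q *ℚ (ι nq *ℚ ι np)     ≡⟨ ℚₚ.*-assoc q _ _ ⟨
    q *ℚ ι nq *ℚ ι np       ≡⟨ cong (_*ℚ ι np) eqq ⟩
    ι mq *ℚ ι np            ≡⟨ ι-* mq np ⟨
    ι (mq * np)             ∎
    where open ≡-Reasoning
  m< : mp * nq <ℕ mq * np
  m< = ι-cancel-< (subst₂ _<ℚ_ p*n≡ q*n≡ (ℚₚ.*-monoˡ-<-pos (ι (np * nq)) {{ι-pos (np * nq) {{n≢0}}}} p<q))

-- Densities and inducibility

-- A positive `r` rules out that the maximum is the default value 0, so some tree attains it.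
maxDensity-attained : ∀ {d D n r} → 0ℚ <ℚ r → r ≤ℚ maxDensity d D n →
                      ∃ λ T → T ∈ daryTrees d n × r ≤ℚ γ D T
maxDensity-attained {d} {D} {n} {r} 0<r r≤ with argmax-sel (λ q → q) 0ℚ (List.map (γ D) (daryTrees d n))
... | inj₁ eq = contradiction 0<r (λ 0<r → ℚₚ.<-irrefl refl (ℚₚ.<-≤-trans 0<r (subst (r ≤ℚ_) eq r≤)))
... | inj₂ ∈γ with T , T∈ , eq ← ∈-map⁻ (γ D) ∈γ = T , T∈ , subst (r ≤ℚ_) eq r≤

γ≤maxDensity : ∀ {d} D {T} → Dary d T → γ D T ≤ℚ maxDensity d D ‖ T ‖
γ≤maxDensity {d} D {T} p = All.lookup (xs≤max 0ℚ (List.map (γ D) (daryTrees d ‖ T ‖)))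
  (∈-map⁺ (γ D) (daryTrees-complete p))

-- The gap between s and the densities of infinitely many trees makes up for
-- the replacement of k! C(n,k) by n^k.

manyCopies : ∀ {d u s} → 0ℚ ≤ℚ s → Below (I d (just u)) s → ∃ λ t →
  Dary⁺ d t × s *ℚ ι (‖ t ‖⁺ ^ ‖ u ‖⁺) ≤ℚ ι (‖ u ‖⁺ ! * copies (just u) t)
manyCopies {d} {u} {s} 0≤s (r , s<r , frequently)
  with x , w , w≢0 , s*w≡x , 1+x≤r*w ← commonDenominator 0≤s s<r
  -- Sizes above `suc x * (k * k)` allow powers to be compared with falling factorials; the outer
  -- `suc` keeps `n` positive, which excludes the empty tree.
  with n , <n , r≤ ← frequently (suc (suc x * (‖ u ‖⁺ * ‖ u ‖⁺)))
  with maxDensity-attained {d} {just u} {n} (ℚₚ.≤-<-trans 0≤s s<r) r≤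
... | nothing , T∈ , _ with refl , _ ← daryTrees-sound {d} {n} T∈ =
      contradiction <n λ ()
... | just t , T∈ , r≤γ with refl , MaybeAll.just t-dary ← daryTrees-sound {d} {n} T∈ =
      t , t-dary , *-cancelʳ-≤-ι w {{w≢0}} (begin
        s *ℚ ι (n ^ k) *ℚ ι w               ≡⟨ swap-right s (ι (n ^ k)) (ι w) ⟩
        s *ℚ ι w *ℚ ι (n ^ k)               ≡⟨ cong (_*ℚ ι (n ^ k)) s*w≡x ⟩
        ι x *ℚ ι (n ^ k)                    ≡⟨ ι-* x (n ^ k) ⟨
        ι (x * n ^ k)                       ≤⟨ ι-mono (x*n^k≤[1+x]*nP′k x n k {{>-nonZero (‖‖⁺>0 t)}} ≤n) ⟩
        ι (suc x * (n P′ k))                  ≡⟨ cong (λ m → ι (suc x * m)) (k!*nCk≡nP′k k≤n) ⟨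
        ι (suc x * (k ! * (n C k)))         ≡⟨ trans (ι-* (suc x) _) (cong (ι (suc x) *ℚ_) (ι-* (k !) (n C k))) ⟩
        ι (suc x) *ℚ (ι (k !) *ℚ ι (n C k))
          ≤⟨ ℚₚ.*-monoʳ-≤-nonNeg _ {{nonNegative (0≤* (0≤ι (k !)) (0≤ι (n C k)))}} 1+x≤r*w ⟩
        r *ℚ ι w *ℚ (ι (k !) *ℚ ι (n C k))  ≡⟨ rearrange r (ι w) (ι (k !)) (ι (n C k)) ⟩
        ι (k !) *ℚ (r *ℚ ι (n C k)) *ℚ ι w
          ≤⟨ *-monoʳ-≤-ι w (*-monoˡ-≤-ι (k !) (≤ratio⇒*≤ (n C k) r≤γ)) ⟩
        ι (k !) *ℚ ι (c (just u) (just t)) *ℚ ι w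
          ≡⟨ cong (_*ℚ ι w) (trans (sym (ι-* (k !) _)) (cong (λ m → ι (k ! * m)) (c≡copies (just u) t))) ⟩
        ι (k ! * copies (just u) t) *ℚ ι w  ∎)
  where
  open ℚₚ.≤-Reasoning
  open +-*-Solver
  k = ‖ u ‖⁺
  ≤n : suc x * (k * k) ≤ℕ n
  ≤n = ℕₚ.<⇒≤ <n
  k≤n : k ≤ℕ n
  k≤n = ℕₚ.≤-trans (ℕₚ.m≤m*n k k {{>-nonZero (‖‖⁺>0 u)}}) (ℕₚ.≤-trans (ℕₚ.m≤m+n _ _) ≤n)
  swap-right : ∀ a b c → a *ℚ b *ℚ c ≡ a *ℚ c *ℚ b
  swap-right = solve 3 (λ a b c → a :* b :* c := a :* c :* b) refl
  rearrange : ∀ r w k b → r *ℚ w *ℚ (k *ℚ b) ≡ k *ℚ (r *ℚ b) *ℚ w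
  rearrange = solve 4 (λ r w k b → r :* w :* (k :* b) := k :* (r :* b) :* w) refl

-- Products of lower cuts

·-below : ∀ x y {q} → 0ℚ ≤ℚ q → Below (x · y) q → ∃ λ r → ∃ λ s →
          0ℚ ≤ℚ r × 0ℚ ≤ℚ s × Below x r × Below y s × q ≤ℚ r *ℚ s
·-below x y 0≤q (inj₁ q<0) = contradiction q<0 (λ q<0 → ℚₚ.<-irrefl refl (ℚₚ.≤-<-trans 0≤q q<0))
·-below x y 0≤q (inj₂ (r , s , 0≤r , 0≤s , r< , s< , q<rs)) = r , s , 0≤r , 0≤s , r< , s< , ℚₚ.<⇒≤ q<rs

-- Replaces a product of cuts by a single natural number, which the later estimates can multiply and
-- cancel.
∏÷1-below : ∀ {A : Set} {n} (f : A → ℕ) (xs : Vec A n) {q} → 0ℚ ≤ℚ q →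
            Below (∏ (map (λ x → f x ÷ 1) xs)) q → q ≤ℚ ι (∏ℕ (map f xs))
∏÷1-below f []       0≤q q< = ℚₚ.≤-trans (ℚₚ.<⇒≤ q<) (ℚₚ.≤-reflexive (sym (ι≡/1 1)))
∏÷1-below f (x ∷ xs) {q} 0≤q q<
  with r , s , 0≤r , 0≤s , r< , s< , q≤rs ← ·-below (f x ÷ 1) (∏ (map (λ x → f x ÷ 1) xs)) 0≤q q< = begin
  q                               ≤⟨ q≤rs ⟩
  r *ℚ s                          ≤⟨ *-mono-≤ (0≤ι (f x)) 0≤s
                                       (ℚₚ.≤-trans (ℚₚ.<⇒≤ r<) (ℚₚ.≤-reflexive (sym (ι≡/1 (f x)))))
                                       (∏÷1-below f xs 0≤s s<) ⟩
  ι (f x) *ℚ ι (∏ℕ (map f xs))    ≡⟨ ι-* (f x) _ ⟨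
  ι (f x * ∏ℕ (map f xs))         ∎
  where open ℚₚ.≤-Reasoning

-- Trees are built only for the nonempty branches: an empty one contributes the factors 0! = 1, 0^0
-- = 1 and inducibility 1. On padded branches this recovers the children of the root.
nonempty : ∀ {n} → Vec Tree n → List Tree⁺
nonempty = List.catMaybes ∘ Vec.toList

nonempty-replicate : ∀ n → nonempty (Vec.replicate n nothing) ≡ []
nonempty-replicate zero    = refl
nonempty-replicate (suc n) = nonempty-replicate n

nonempty-padRight : ∀ {d} ts (≤d : length ts ≤ℕ d) →
                    nonempty (Vec.padRight ≤d nothing (map just (Vec.fromList ts))) ≡ ts
nonempty-padRight {d} []   z≤n      = nonempty-replicate d
nonempty-padRight (t ∷ ts) (s≤s ≤d) = cong (t ∷_) (nonempty-padRight ts ≤d)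

selfPower : Tree → ℕ
selfPower T = ‖ T ‖ ^ ‖ T ‖

factorials : ∀ {n} → Vec Tree n → ℕ
factorials Ds = ∏ℕ (map _! (map ‖_‖ Ds))

-- Blowing up the trees found for the individual branches makes their sizes
-- exactly proportional to the sizes of the branches.

proportionalTrees : ∀ {d n} → 2 ≤ℕ d → (Ds : Vec Tree n) → ∀ {s} → 0ℚ ≤ℚ s →
  Below (∏ (map (I d) Ds)) s → ∀ N → ∃ λ P → ∃ λ ts →
  N <ℕ P × All (Dary⁺ d) ts × length ts ≡ length (nonempty Ds) × ‖ ts ‖* ≡ ‖ nonempty Ds ‖* * P ×
  s *ℚ ι (∏ℕ (map selfPower Ds) * P ^ ‖ nonempty Ds ‖*) ≤ℚ ι (factorials Ds * copies* (nonempty Ds) ts)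
-- With no branch left, both sizes are 0, and any `P` above `N` will do.
proportionalTrees 2≤d [] {s} 0≤s s<1 N =
  suc N , [] , ℕₚ.≤-refl , [] , refl , refl ,
  ℚₚ.≤-trans (*-monoʳ-≤-ι 1 (ℚₚ.<⇒≤ s<1)) (ℚₚ.≤-reflexive (ℚₚ.*-identityˡ (ι 1)))
proportionalTrees {d} 2≤d (nothing ∷ Ds) {s} 0≤s s< N
  with a , b , 0≤a , 0≤b , a<1 , b< , s≤ab ← ·-below 1ℝ (∏ (map (I d) Ds)) 0≤s s<
  with P , ts , N<P , dary , length≡ , ‖ts‖≡ , bound ← proportionalTrees 2≤d Ds 0≤b b< N =
  P , ts , N<P , dary , length≡ , ‖ts‖≡ , (begin
    s *ℚ ι (1 * ∏ℕ (map selfPower Ds) * P ^ K)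
      ≡⟨ cong (λ m → s *ℚ ι (m * P ^ K)) (ℕₚ.*-identityˡ (∏ℕ (map selfPower Ds))) ⟩
    s *ℚ ι (∏ℕ (map selfPower Ds) * P ^ K)   ≤⟨ *-monoʳ-≤-ι (∏ℕ (map selfPower Ds) * P ^ K) s≤b ⟩
    b *ℚ ι (∏ℕ (map selfPower Ds) * P ^ K)   ≤⟨ bound ⟩
    ι (factorials Ds * copies* (nonempty Ds) ts)
      ≡⟨ cong (λ m → ι (m * copies* (nonempty Ds) ts)) (ℕₚ.*-identityˡ (factorials Ds)) ⟨
    ι (1 * factorials Ds * copies* (nonempty Ds) ts) ∎)
  where
  open ℚₚ.≤-Reasoning
  K = ‖ nonempty Ds ‖*
  -- The factor `a` of the empty branch is below its inducibility 1.
  s≤b : s ≤ℚ b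
  s≤b = ℚₚ.≤-trans s≤ab (ℚₚ.≤-trans (ℚₚ.*-monoʳ-≤-nonNeg b {{nonNegative 0≤b}} (ℚₚ.<⇒≤ a<1))
    (ℚₚ.≤-reflexive (ℚₚ.*-identityˡ b)))
proportionalTrees {d} 2≤d (just u ∷ Ds) {s} 0≤s s< N
  with a , b , 0≤a , 0≤b , a< , b< , s≤ab ← ·-below (I d (just u)) (∏ (map (I d) Ds)) 0≤s s<
  with P@(suc _) , ts , N<P , dary , length≡ , ‖ts‖≡ , bounds ← proportionalTrees 2≤d Ds 0≤b b< N
  with t , t-dary , bound ← manyCopies {u = u} 0≤a a< =
  -- `t` has `n` leaves and `ts` has `K * P`. Caterpillars with `k * P` and with `n` leaves,
  -- respectively, bring them to `k * (P * n)` and `K * (P * n)`, so `P * n` is the new common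
  -- factor.
  P * n , blowUp m′ t ∷ blowUp* n′ ts ,
  ℕₚ.≤-trans N<P (ℕₚ.m≤m*n P n) ,
  blowUp-dary 2≤d m′ t-dary ∷ blowUp*-dary 2≤d n′ dary ,
  cong suc (trans (length-blowUp* n′ ts) length≡) ,
  ‖‖≡ ,
  scaled
  where
  k = ‖ u ‖⁺
  K = ‖ nonempty Ds ‖*
  n = ‖ t ‖⁺
  instance
    n≢0 : NonZero n
    n≢0 = >-nonZero (‖‖⁺>0 t)
    k≢0 : NonZero k
    k≢0 = >-nonZero (‖‖⁺>0 u)
  -- The index of a caterpillar is one less than its number of leaves, hence the predecessors.
  n′ = pred n
  m′ = pred (k * P)
  n≡ : suc n′ ≡ n
  n≡ = ℕₚ.suc-pred n
  m≡ : suc m′ ≡ k * P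
  m≡ = ℕₚ.suc-pred (k * P) {{ℕₚ.m*n≢0 k P}}
  sizes : ∀ n k p l → n * (k * p) + l * p * n ≡ (k + l) * (p * n)
  sizes = solve-∀
  ‖‖≡ : ‖ blowUp m′ t ‖⁺ + ‖ blowUp* n′ ts ‖* ≡ (k + K) * (P * n)
  ‖‖≡ = begin
    ‖ blowUp m′ t ‖⁺ + ‖ blowUp* n′ ts ‖*  ≡⟨ cong₂ _+_ (‖blowUp‖ m′ t) (‖blowUp*‖ n′ ts) ⟩
    n * suc m′ + ‖ ts ‖* * suc n′          ≡⟨ cong₂ _+_ (cong (n *_) m≡) (cong₂ _*_ ‖ts‖≡ n≡) ⟩
    n * (k * P) + K * P * n                ≡⟨ sizes n k P K ⟩
    (k + K) * (P * n)                      ∎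
    where open ≡-Reasoning
  E = ∏ℕ (map selfPower Ds)
  F = factorials Ds
  x = copies (just u) t
  y = copies* (nonempty Ds) ts
  copies≥ : ((k * P) ^ k * x) * (n ^ K * y) ≤ℕ copies* (u ∷ nonempty Ds) (blowUp m′ t ∷ blowUp* n′ ts)
  copies≥ = begin
    ((k * P) ^ k * x) * (n ^ K * y)
      ≡⟨ cong₂ (λ i j → (i ^ k * x) * (j ^ K * y)) m≡ n≡ ⟨
    (suc m′ ^ k * x) * (suc n′ ^ K * y)
      ≤⟨ ℕₚ.*-mono-≤ (copies-blowUp m′ (just u) t) (copies*-blowUp* n′ (nonempty Ds) ts) ⟩
    copies (just u) (blowUp m′ t) * copies* (nonempty Ds) (blowUp* n′ ts)
      ≤⟨ copies*-∷ u (nonempty Ds) (blowUp m′ t) (blowUp* n′ ts) ⟩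
    copies* (u ∷ nonempty Ds) (blowUp m′ t ∷ blowUp* n′ ts) ∎
    where open ℕₚ.≤-Reasoning
  -- Both sides acquire the same factor `k ^ k * P ^ k * n ^ K`: `powers` extracts it from the power
  -- of the new size, `counts` absorbs it into the number of copies after blowing up.
  regroup₁ : ∀ kk E Pk PK nk nK → kk * E * ((Pk * nk) * (PK * nK)) ≡ nk * (E * PK) * (kk * Pk * nK)
  regroup₁ = solve-∀
  regroup₂ : ∀ k! F kk Pk nK x y → (k! * x) * (F * y) * (kk * Pk * nK) ≡ k! * F * (kk * Pk * x * (nK * y))
  regroup₂ = solve-∀
  powers : (k ^ k * E) * (P * n) ^ (k + K) ≡ n ^ k * (E * P ^ K) * (k ^ k * P ^ k * n ^ K)
  powers = trans (cong (k ^ k * E *_) (trans (ℕₚ.^-distribˡ-+-* (P * n) k K)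
      (cong₂ _*_ (^-distribʳ-* k P n) (^-distribʳ-* K P n))))
    (regroup₁ (k ^ k) E (P ^ k) (P ^ K) (n ^ k) (n ^ K))
  counts : (k ! * x) * (F * y) * (k ^ k * P ^ k * n ^ K) ≡ k ! * F * (((k * P) ^ k * x) * (n ^ K * y))
  counts = trans (regroup₂ (k !) F (k ^ k) (P ^ k) (n ^ K) x y)
    (cong (λ i → k ! * F * (i * x * (n ^ K * y))) (sym (^-distribʳ-* k k P)))
  scaled : s *ℚ ι ((k ^ k * E) * (P * n) ^ (k + K)) ≤ℚ
           ι (k ! * F * copies* (u ∷ nonempty Ds) (blowUp m′ t ∷ blowUp* n′ ts))
  scaled = begin
    s *ℚ ι ((k ^ k * E) * (P * n) ^ (k + K))
      ≤⟨ *-monoʳ-≤-ι ((k ^ k * E) * (P * n) ^ (k + K)) s≤ab ⟩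
    a *ℚ b *ℚ ι ((k ^ k * E) * (P * n) ^ (k + K))
      ≡⟨ cong (λ i → a *ℚ b *ℚ ι i) powers ⟩
    a *ℚ b *ℚ ι (n ^ k * (E * P ^ K) * M)
      ≡⟨ cong (a *ℚ b *ℚ_) (trans (ι-* (n ^ k * (E * P ^ K)) M) (cong (_*ℚ ι M) (ι-* (n ^ k) (E * P ^ K)))) ⟩
    a *ℚ b *ℚ (ι (n ^ k) *ℚ ι (E * P ^ K) *ℚ ι M)
      ≡⟨ interchange a b (ι (n ^ k)) (ι (E * P ^ K)) (ι M) ⟩
    (a *ℚ ι (n ^ k)) *ℚ (b *ℚ ι (E * P ^ K)) *ℚ ι M
      ≤⟨ *-monoʳ-≤-ι M (*-mono-≤ (0≤ι (k ! * x)) (0≤* 0≤b (0≤ι (E * P ^ K))) bound bounds) ⟩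
    ι (k ! * x) *ℚ ι (F * y) *ℚ ι M
      ≡⟨ trans (cong (_*ℚ ι M) (sym (ι-* (k ! * x) (F * y)))) (sym (ι-* (k ! * x * (F * y)) M)) ⟩
    ι ((k ! * x) * (F * y) * M)
      ≡⟨ cong ι counts ⟩
    ι (k ! * F * (((k * P) ^ k * x) * (n ^ K * y)))
      ≤⟨ ι-mono (ℕₚ.*-monoʳ-≤ (k ! * F) copies≥) ⟩
    ι (k ! * F * copies* (u ∷ nonempty Ds) (blowUp m′ t ∷ blowUp* n′ ts)) ∎
    where
    open ℚₚ.≤-Reasoning
    M = k ^ k * P ^ k * n ^ K
    interchange : ∀ a b c d e → a *ℚ b *ℚ (c *ℚ d *ℚ e) ≡ (a *ℚ c) *ℚ (b *ℚ d) *ℚ e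
    interchange = solve 5 (λ a b c d e → a :* b :* (c :* d :* e) := (a :* c) :* (b :* d) :* e) refl
      where open +-*-Solver

-- Here K is the number of leaves of D, F and E are the products of the
-- factorials and of the self-powers of the numbers of leaves of its branches,
-- and x is a number of copies of D in a tree with K P leaves.

density-bound : ∀ K P F E x {u v e s} .{{_ : NonZero P}} (F≢0 : NonZero F) →
  0ℚ ≤ℚ v → 0ℚ ≤ℚ e → 0ℚ ≤ℚ s →
  u ≤ℚ (+ (K !) / F) {{F≢0}} → v ≤ℚ (+ 1 / (K ^ K)) {{n^n≢0 K}} → e ≤ℚ ι E →
  s *ℚ ι (E * P ^ K) ≤ℚ ι (F * x) →
  u *ℚ v *ℚ e *ℚ s ≤ℚ ratio x ((K * P) C K)
density-bound K P F E x {u} {v} {e} {s} F≢0 0≤v 0≤e 0≤s u≤ v≤ e≤ s≤ =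
  *≤⇒≤ratio B {{nCk≢0 K≤KP}} (*-cancelʳ-≤-ι F {{F≢0}} (begin
    u *ℚ v *ℚ e *ℚ s *ℚ ι B *ℚ ι F
      ≡⟨ solve 6 (λ u v e s B F → u :* v :* e :* s :* B :* F := (u :* F) :* (B :* (v :* e :* s))) refl u v e s (ι B) (ι F) ⟩
    (u *ℚ ι F) *ℚ (ι B *ℚ (v *ℚ e *ℚ s))
      ≤⟨ ℚₚ.*-monoʳ-≤-nonNeg _ {{nonNegative (0≤* (0≤ι B) 0≤ves)}} (≤/⇒*≤ {m = K !} {F} {{F≢0}} u≤) ⟩
    ι (K !) *ℚ (ι B *ℚ (v *ℚ e *ℚ s))
      ≡⟨ trans (sym (ℚₚ.*-assoc (ι (K !)) (ι B) _)) (cong (_*ℚ (v *ℚ e *ℚ s)) (sym (ι-* (K !) B))) ⟩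
    ι (K ! * B) *ℚ (v *ℚ e *ℚ s)
      ≤⟨ ℚₚ.*-monoʳ-≤-nonNeg _ {{nonNegative 0≤ves}} (ι-mono (k!*nCk≤n^k K≤KP)) ⟩
    ι ((K * P) ^ K) *ℚ (v *ℚ e *ℚ s)
      ≡⟨ cong (_*ℚ (v *ℚ e *ℚ s)) (trans (cong ι (^-distribʳ-* K K P)) (ι-* (K ^ K) (P ^ K))) ⟩
    ι (K ^ K) *ℚ ι (P ^ K) *ℚ (v *ℚ e *ℚ s)
      -- `K ^ K` is to cancel against `v`, while `P ^ K` joins `s`, as in the hypothesis on the
      -- copies.
      ≡⟨ solve 5 (λ k p v e s → k :* p :* (v :* e :* s) := (v :* k) :* (e :* (s :* p))) refl (ι (K ^ K)) (ι (P ^ K)) v e s ⟩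
    (v *ℚ ι (K ^ K)) *ℚ (e *ℚ (s *ℚ ι (P ^ K)))
      ≤⟨ *-mono-≤ (0≤ι 1) (0≤* 0≤e 0≤sp) (≤/⇒*≤ {m = 1} {K ^ K} {{n^n≢0 K}} v≤)
           (ℚₚ.*-monoʳ-≤-nonNeg _ {{nonNegative 0≤sp}} e≤) ⟩
    ι 1 *ℚ (ι E *ℚ (s *ℚ ι (P ^ K)))
      ≡⟨ trans (cong (_*ℚ (ι E *ℚ (s *ℚ ι (P ^ K)))) ι-1) (ℚₚ.*-identityˡ _) ⟩
    ι E *ℚ (s *ℚ ι (P ^ K))
      ≡⟨ solve 3 (λ e s p → e :* (s :* p) := s :* (e :* p)) refl (ι E) s (ι (P ^ K)) ⟩
    s *ℚ (ι E *ℚ ι (P ^ K))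
      ≡⟨ cong (s *ℚ_) (ι-* E (P ^ K)) ⟨
    s *ℚ ι (E * P ^ K)
      ≤⟨ s≤ ⟩
    ι (F * x)
      ≡⟨ trans (cong ι (ℕₚ.*-comm F x)) (ι-* x F) ⟩
    ι x *ℚ ι F ∎))
  where
  open ℚₚ.≤-Reasoning
  open +-*-Solver
  B = (K * P) C K
  K≤KP : K ≤ℕ K * P
  K≤KP = ℕₚ.m≤m*n K P
  0≤ves : 0ℚ ≤ℚ v *ℚ e *ℚ s
  0≤ves = 0≤* (0≤* 0≤v 0≤e) 0≤s
  0≤sp : 0ℚ ≤ℚ s *ℚ ι (P ^ K)
  0≤sp = 0≤* 0≤s (0≤ι (P ^ K))

-- `copies*` is a lower bound for the true number `c` of copies in `node ts`, so the preceding
-- estimate applies to `c`.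
node-density-bound : ∀ us ts P F E {u v e s} .{{_ : NonZero P}} (F≢0 : NonZero F) →
  2 ≤ℕ length us → 2 ≤ℕ length ts → ‖ ts ‖* ≡ ‖ us ‖* * P →
  0ℚ ≤ℚ v → 0ℚ ≤ℚ e → 0ℚ ≤ℚ s →
  u ≤ℚ (+ (‖ us ‖* !) / F) {{F≢0}} → v ≤ℚ (+ 1 / (‖ us ‖* ^ ‖ us ‖*)) {{n^n≢0 ‖ us ‖*}} → e ≤ℚ ι E →
  s *ℚ ι (E * P ^ ‖ us ‖*) ≤ℚ ι (F * copies* us ts) →
  u *ℚ v *ℚ e *ℚ s ≤ℚ γ (just (node us)) (just (node ts))
node-density-bound us ts P F E {u} {v} {e} {s} F≢0 2≤us 2≤ts ‖ts‖≡ 0≤v 0≤e 0≤s u≤ v≤ e≤ s≤ =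
  subst₂ (λ n k → u *ℚ v *ℚ e *ℚ s ≤ℚ ratio x (n C k))
    (sym (trans (‖node‖⁺ ts 2≤ts) ‖ts‖≡)) (sym (‖node‖⁺ us 2≤us))
    (density-bound ‖ us ‖* P F E x F≢0 0≤v 0≤e 0≤s u≤ v≤ e≤
      (ℚₚ.≤-trans s≤ (ι-mono (ℕₚ.*-monoʳ-≤ F x≥))))
  where
  x = c (just (node us)) (just (node ts))
  x≥ : copies* us ts ≤ℕ x
  x≥ = ℕₚ.≤-trans (copies*≤copies us ts 2≤us 2≤ts) (ℕₚ.≤-reflexive (sym (c≡copies (just (node us)) (node ts))))

-- The list `us` of children is tied to the padded vector `Ds` by an equation, since the two agree
-- only after the padding is removed.
denseTrees : ∀ {d n us} → 2 ≤ℕ d → 2 ≤ℕ length us → length us ≤ℕ d →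
  (Ds : Vec Tree n) → nonempty Ds ≡ us → ∀ {u v e s} → 0ℚ ≤ℚ v → 0ℚ ≤ℚ e → 0ℚ ≤ℚ s →
  Below (multinomial ‖ us ‖* (map ‖_‖ Ds)) u →
  Below ((1 ÷ (‖ us ‖* ^ ‖ us ‖*)) {{n^n≢0 ‖ us ‖*}}) v →
  Below (∏ (map (λ Dᵢ → selfPower Dᵢ ÷ 1) Ds)) e →
  Below (∏ (map (I d) Ds)) s →
  ∀ N → ∃ λ n → N ≤ℕ n × u *ℚ v *ℚ e *ℚ s ≤ℚ maxDensity d (just (node us)) n
denseTrees {d} {us = us} 2≤d 2≤us us≤d Ds refl 0≤v 0≤e 0≤s u< v< e< s< N =
  let
    P , ts , N<P , ts-dary , length≡ , ‖ts‖≡ , bound = proportionalTrees 2≤d Ds 0≤s s< N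
    2≤ts    = subst (2 ≤ℕ_) (sym length≡) 2≤us
    ts≤d    = subst (_≤ℕ d) (sym length≡) us≤d
    ‖node‖≡ = trans (‖node‖⁺ ts 2≤ts) ‖ts‖≡
    us≢0    = >-nonZero (subst (1 ≤ℕ_) (‖node‖⁺ us 2≤us) (‖‖⁺>0 (node us)))
  in
  ‖ node ts ‖⁺ ,
  -- The tree has `‖ us ‖* * P` leaves, where the first factor is positive and `P` exceeds `N`.
  ℕₚ.≤-trans (ℕₚ.<⇒≤ N<P) (ℕₚ.≤-trans (ℕₚ.m≤n*m P ‖ us ‖* {{us≢0}}) (ℕₚ.≤-reflexive (sym ‖node‖≡))) ,
  ℚₚ.≤-trans
    (node-density-bound us ts P (factorials Ds) (∏ℕ (map selfPower Ds))
      {{>-nonZero (ℕₚ.≤-<-trans z≤n N<P)}} (∏!≢0 (map ‖_‖ Ds)) 2≤us 2≤ts ‖ts‖≡ 0≤v 0≤e 0≤s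
      (ℚₚ.<⇒≤ u<) (ℚₚ.<⇒≤ v<) (∏÷1-below selfPower Ds 0≤e e<) bound)
    (γ≤maxDensity (just (node us)) (MaybeAll.just (node 2≤ts ts≤d ts-dary)))

theorem12 : (d : ℕ) → 2 ≤ℕ d →
    (D : Tree) (D-dary : Dary d D) → 2 ≤ℕ ‖ D ‖ →
    let Ds = branches D D-dary in
    I d D ≥
    multinomial ‖ D ‖ (map ‖_‖ Ds)
    · (1 ÷ (‖ D ‖ ^ ‖ D ‖)) {{n^n≢0 ‖ D ‖}}
    · ∏ (map (λ Dᵢ → (‖ Dᵢ ‖ ^ ‖ Dᵢ ‖) ÷ 1) Ds)
    · ∏ (map (I d) Ds)
theorem12 d 2≤d (just (node [])) (MaybeAll.just leaf) (s≤s ())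
theorem12 d 2≤d D@(just (node (_ ∷ _))) _ _ (inj₁ q<0) = negative (I d D) q<0
-- The limit superior needs a threshold above `q` that does not depend on `N`. It is `a *ℚ s`, which
-- the product cut already places strictly above `q`.
theorem12 d 2≤d D@(just (node us@(_ ∷ _))) D-dary@(MaybeAll.just (node 2≤us us≤d _)) _
  (inj₂ (a , s , 0≤a , 0≤s , a< , s< , q<as)) = a *ℚ s , q<as , λ N →
    let
      -- Products associate to the left, so the factors are split off from the right.
      b , e , 0≤b , 0≤e , b< , e< , a≤be = ·-below (Multinomial · SelfPower⁻¹) SelfPowers 0≤a a<
      u , v , 0≤u , 0≤v , u< , v< , b≤uv = ·-below Multinomial SelfPower⁻¹ 0≤b b<
      n , N≤n , dense = denseTrees 2≤d 2≤us us≤d Ds (nonempty-padRight us us≤d) 0≤v 0≤e 0≤s u< v< e< s< N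
      a≤uve = ℚₚ.≤-trans a≤be (ℚₚ.*-monoʳ-≤-nonNeg e {{nonNegative 0≤e}} b≤uv)
    in n , N≤n , ℚₚ.≤-trans (ℚₚ.*-monoʳ-≤-nonNeg s {{nonNegative 0≤s}} a≤uve) dense
  where
  Ds = branches D D-dary
  Multinomial = multinomial ‖ D ‖ (map ‖_‖ Ds)
  SelfPower⁻¹ = (1 ÷ (‖ D ‖ ^ ‖ D ‖)) {{n^n≢0 ‖ D ‖}}
  SelfPowers  = ∏ (map (λ Dᵢ → selfPower Dᵢ ÷ 1) Ds)
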